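{- The Markov category $\mathsf{TLinRel}$ of total linear relations is equivalent to the Markov category $\mathsf{Copar}(\mathsf{Vec})$ of copartial maps in $\mathsf{Vec}$.
   Context: A Markov category is a symmetric monoidal category in which every object $X$ carries a commutative comonoid structure $\mathsf{copy}_X:X\to X\otimes X$, $\mathsf{del}_X:X\to I$, compatible with the tensor product, such that $\mathsf{del}$ is natural. Equivalence of Markov categories means an equivalence compatible with the symmetric monoidal structure and with $\mathsf{copy}$ and $\mathsf{del}$. $\mathsf{Vec}$ is the category of finite-dimensional vector spaces $\mathbb R^n$ ($n\ge0$) and linear maps. **$\mathsf{TLinRel}$:** objects are the spaces $\mathbb R^n$. Morphisms $X\to Y$ are linear relations, i.e. vector subspaces $\mathbb L\subseteq X\times Y$, which are total: for every $x\in X$ there is $y\in Y$ with $(x,y)\in\mathbb L$. Composition is relational composition $R;S=\{(x,z):\exists y,\ (x,y)\in R,\ (y,z)\in S\}$, and the identity is the diagonal. The tensor is the product on objects, with $R_1\otimes R_2=\{((x_1,x_2),(y_1,y_2)):(x_i,y_i)\in R_i\}$ and unit $\mathbb R^0$. Also $\mathsf{copy}_X=\{(x,(x,x))\}$ and $\mathsf{del}_X=\{(x,0)\}\subseteq X\times\mathbb R^0$. **$\mathsf{Copar}(\mathsf{Vec})$:** objects are the spaces $\mathbb R^n$. Morphisms $X\to Y$ (copartial maps) are cospans of linear maps $X\xrightarrow{f}P\xleftarrow{p}Y$ with $p$ surjective, up to isomorphism of the apex $P$ commuting with both legs. The identity is $X\xrightarrow{\mathsf{id}}X\xleftarrow{\mathsf{id}}X$,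 and composition is by pushout. The monoidal structure is given by the biproduct ($X\otimes Y=X\times Y$, acting componentwise on cospans) with unit $\mathbb R^0$. Copy and delete are the cospans $X\xrightarrow{\Delta}X\times X\xleftarrow{\mathsf{id}}X\times X$, where $\Delta$ is the diagonal, and $X\xrightarrow{!}\mathbb R^0\xleftarrow{\mathsf{id}}\mathbb R^0$. -}

module Defs where

open import Algebra.Bundles using (CommutativeRing)
open import Algebra.Module.Bundles using (LeftModule)
open import Algebra.Module.Morphism.Structures using (IsLeftModuleHomomorphism)
open import Algebra.Structures using (IsCommutativeRing)
import Algebra.Construct.Pointwise as Pointwise
import Algebra.Properties.CommutativeSemigroup as CommutativeSemigroupProperties
import Algebra.Properties.Ring as RingProperties
open import Axiom.ExcludedMiddle using (ExcludedMiddle)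
open import Data.Fin.Base using (Fin; zero; suc; punchIn; punchOut; splitAt; _↑ˡ_; _↑ʳ_)
open import Data.Fin.Properties using (splitAt-↑ˡ; splitAt-↑ʳ; punchIn-punchOut; _≟_)
open import Data.Nat.Base using (ℕ; zero; suc; _+_)
open import Data.Product.Base using (∃; ∃-syntax; _×_; _,_; proj₁; proj₂)
open import Data.Sum.Base using (inj₁; inj₂)
open import Data.Unit.Base using (⊤; tt)
open import Data.Vec.Functional
  using (Vector; []; _∷_; _++_; take; drop; map; zipWith; replicate; tail; removeAt; insertAt)
open import Data.Vec.Functional.Properties using (insertAt-punchIn; insertAt-lookup)
import Data.Vec.Functional.Relation.Binary.Equality.Setoid as VecEquality
import Data.Vec.Functional.Relation.Binary.Pointwise.Properties as PointwiseProperties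
open import Function.Definitions using (Surjective)
open import Level using (Level; 0ℓ; _⊔_) renaming (suc to lsuc)
open import Relation.Binary.Core using (Rel; REL; _⇔_)
open import Relation.Binary.PropositionalEquality.Core as ≡ using (_≡_)
open import Relation.Binary.Structures using (IsEquivalence; IsTotalOrder)
open import Relation.Nullary using (¬_; Dec; yes; no)
open import Relation.Unary using (Pred; Satisfiable)

-- Composition is written in diagrammatic order throughout.

record Category (o h e : Level) : Set (lsuc (o ⊔ h ⊔ e)) where
  infix  4 _≈_
  infixl 7 _⨾_
  field
    Obj  : Set o
    Hom  : Obj → Obj → Set h
    _≈_  : ∀ {A B} → Rel (Hom A B) e
    id   : ∀ {A} → Hom A A
    _⨾_  : ∀ {A B C} → Hom A B → Hom B C → Hom A C
    isEquivalence : ∀ {A B} → IsEquivalence (_≈_ {A} {B})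
    ⨾-cong    : ∀ {A B C} {f f′ : Hom A B} {g g′ : Hom B C} →
                f ≈ f′ → g ≈ g′ → f ⨾ g ≈ f′ ⨾ g′
    identityˡ : ∀ {A B} (f : Hom A B) → id ⨾ f ≈ f
    identityʳ : ∀ {A B} (f : Hom A B) → f ⨾ id ≈ f
    assoc     : ∀ {A B C D} (f : Hom A B) (g : Hom B C) (h : Hom C D) →
                (f ⨾ g) ⨾ h ≈ f ⨾ (g ⨾ h)

  module _ {A B : Obj} where
    open IsEquivalence (isEquivalence {A} {B}) public
      using () renaming (refl to ≈-refl; sym to ≈-sym; trans to ≈-trans)

  infix 4 _≅_
  record _≅_ (A B : Obj) : Set (h ⊔ e) where
    field
      to       : Hom A B
      from     : Hom B A
      to⨾from  : to ⨾ from ≈ id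
      from⨾to  : from ⨾ to ≈ id

  open _≅_ public

  record IsPushout {A B C P : Obj} (f : Hom A B) (g : Hom A C)
                   (i₁ : Hom B P) (i₂ : Hom C P) : Set (o ⊔ h ⊔ e) where
    field
      commutes  : f ⨾ i₁ ≈ g ⨾ i₂
      universal : ∀ {Q} (k₁ : Hom B Q) (k₂ : Hom C Q) → f ⨾ k₁ ≈ g ⨾ k₂ → Hom P Q
      i₁⨾universal : ∀ {Q} (k₁ : Hom B Q) (k₂ : Hom C Q) (eq : f ⨾ k₁ ≈ g ⨾ k₂) →
                     i₁ ⨾ universal k₁ k₂ eq ≈ k₁
      i₂⨾universal : ∀ {Q} (k₁ : Hom B Q) (k₂ : Hom C Q) (eq : f ⨾ k₁ ≈ g ⨾ k₂) →
                     i₂ ⨾ universal k₁ k₂ eq ≈ k₂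
      unique : ∀ {Q} (u v : Hom P Q) → i₁ ⨾ u ≈ i₁ ⨾ v → i₂ ⨾ u ≈ i₂ ⨾ v → u ≈ v

record SymmetricMonoidal {o h e : Level} (𝒞 : Category o h e) : Set (o ⊔ h ⊔ e) where
  open Category 𝒞
  infixr 10 _⊗₀_ _⊗₁_
  field
    _⊗₀_   : Obj → Obj → Obj
    unit   : Obj
    _⊗₁_   : ∀ {A B C D} → Hom A B → Hom C D → Hom (A ⊗₀ C) (B ⊗₀ D)
    ⊗-cong : ∀ {A B C D} {f f′ : Hom A B} {g g′ : Hom C D} →
             f ≈ f′ → g ≈ g′ → f ⊗₁ g ≈ f′ ⊗₁ g′
    ⊗-id   : ∀ {A B} → id {A} ⊗₁ id {B} ≈ id
    ⊗-⨾    : ∀ {A B C A′ B′ C′} (f : Hom A B) (g : Hom B C) (f′ : Hom A′ B′) (g′ : Hom B′ C′) →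
             (f ⨾ g) ⊗₁ (f′ ⨾ g′) ≈ (f ⊗₁ f′) ⨾ (g ⊗₁ g′)

    associator : ∀ A B C → (A ⊗₀ B) ⊗₀ C ≅ A ⊗₀ (B ⊗₀ C)
    unitorˡ    : ∀ A → unit ⊗₀ A ≅ A
    unitorʳ    : ∀ A → A ⊗₀ unit ≅ A
    braiding   : ∀ A B → Hom (A ⊗₀ B) (B ⊗₀ A)

    associator-natural : ∀ {A B C A′ B′ C′} (f : Hom A A′) (g : Hom B B′) (h : Hom C C′) →
      ((f ⊗₁ g) ⊗₁ h) ⨾ to (associator A′ B′ C′) ≈ to (associator A B C) ⨾ (f ⊗₁ (g ⊗₁ h))
    unitorˡ-natural : ∀ {A A′} (f : Hom A A′) →
      (id ⊗₁ f) ⨾ to (unitorˡ A′) ≈ to (unitorˡ A) ⨾ f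
    unitorʳ-natural : ∀ {A A′} (f : Hom A A′) →
      (f ⊗₁ id) ⨾ to (unitorʳ A′) ≈ to (unitorʳ A) ⨾ f
    braiding-natural : ∀ {A B A′ B′} (f : Hom A A′) (g : Hom B B′) →
      (f ⊗₁ g) ⨾ braiding A′ B′ ≈ braiding A B ⨾ (g ⊗₁ f)

    triangle : ∀ A B →
      to (associator A unit B) ⨾ (id ⊗₁ to (unitorˡ B)) ≈ to (unitorʳ A) ⊗₁ id
    pentagon : ∀ A B C D →
      to (associator (A ⊗₀ B) C D) ⨾ to (associator A B (C ⊗₀ D)) ≈
      (to (associator A B C) ⊗₁ id) ⨾ to (associator A (B ⊗₀ C) D) ⨾ (id ⊗₁ to (associator B C D))
    hexagon : ∀ A B C →
      to (associator A B C) ⨾ braiding A (B ⊗₀ C) ⨾ to (associator B C A) ≈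
      (braiding A B ⊗₁ id) ⨾ to (associator B A C) ⨾ (id ⊗₁ braiding A C)
    braiding-involutive : ∀ A B → braiding A B ⨾ braiding B A ≈ id

  middleSwap : ∀ A B C D → Hom ((A ⊗₀ B) ⊗₀ (C ⊗₀ D)) ((A ⊗₀ C) ⊗₀ (B ⊗₀ D))
  middleSwap A B C D =
    to (associator A B (C ⊗₀ D)) ⨾
    (id ⊗₁ (from (associator B C D) ⨾ (braiding B C ⊗₁ id) ⨾ to (associator C B D))) ⨾
    from (associator A C (B ⊗₀ D))

record MarkovCategory (o h e : Level) : Set (lsuc (o ⊔ h ⊔ e)) where
  field
    category          : Category o h e
    symmetricMonoidal : SymmetricMonoidal category

  open Category category public
  open SymmetricMonoidal symmetricMonoidal public

  field
    copy : ∀ A → Hom A (A ⊗₀ A)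
    del  : ∀ A → Hom A unit

    copy-assoc : ∀ A → copy A ⨾ (copy A ⊗₁ id) ⨾ to (associator A A A) ≈ copy A ⨾ (id ⊗₁ copy A)
    copy-comm  : ∀ A → copy A ⨾ braiding A A ≈ copy A
    copy-delˡ  : ∀ A → copy A ⨾ (del A ⊗₁ id) ⨾ to (unitorˡ A) ≈ id

    copy-⊗    : ∀ A B → copy (A ⊗₀ B) ≈ (copy A ⊗₁ copy B) ⨾ middleSwap A A B B
    del-⊗     : ∀ A B → del (A ⊗₀ B) ≈ (del A ⊗₁ del B) ⨾ to (unitorˡ unit)
    copy-unit : copy unit ⨾ to (unitorˡ unit) ≈ id
    del-unit  : del unit ≈ id

    del-natural : ∀ {A B} (f : Hom A B) → f ⨾ del B ≈ del A

record MarkovFunctor {o h e o′ h′ e′ : Level}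
                     (𝒞 : MarkovCategory o h e) (𝒟 : MarkovCategory o′ h′ e′) :
                     Set (o ⊔ h ⊔ e ⊔ o′ ⊔ h′ ⊔ e′) where
  private
    module C = MarkovCategory 𝒞
    module D = MarkovCategory 𝒟
  open D using (_≈_; _⨾_; _⊗₁_; to)
  field
    F₀     : C.Obj → D.Obj
    F₁     : ∀ {A B} → C.Hom A B → D.Hom (F₀ A) (F₀ B)
    F-cong : ∀ {A B} {f g : C.Hom A B} → f C.≈ g → F₁ f ≈ F₁ g
    F-id   : ∀ {A} → F₁ (C.id {A}) ≈ D.id
    F-⨾    : ∀ {A B E} (f : C.Hom A B) (g : C.Hom B E) → F₁ (f C.⨾ g) ≈ F₁ f ⨾ F₁ g

    ε : D.unit D.≅ F₀ C.unit
    μ : ∀ A B → F₀ A D.⊗₀ F₀ B D.≅ F₀ (A C.⊗₀ B)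

    μ-natural : ∀ {A B A′ B′} (f : C.Hom A A′) (g : C.Hom B B′) →
      (F₁ f ⊗₁ F₁ g) ⨾ to (μ A′ B′) ≈ to (μ A B) ⨾ F₁ (f C.⊗₁ g)
    μ-assoc : ∀ A B E →
      (to (μ A B) ⊗₁ D.id) ⨾ to (μ (A C.⊗₀ B) E) ⨾ F₁ (C.to (C.associator A B E)) ≈
      to (D.associator (F₀ A) (F₀ B) (F₀ E)) ⨾ (D.id ⊗₁ to (μ B E)) ⨾ to (μ A (B C.⊗₀ E))
    μ-unitˡ : ∀ A →
      (to ε ⊗₁ D.id) ⨾ to (μ C.unit A) ⨾ F₁ (C.to (C.unitorˡ A)) ≈ to (D.unitorˡ (F₀ A))
    μ-unitʳ : ∀ A →
      (D.id ⊗₁ to ε) ⨾ to (μ A C.unit) ⨾ F₁ (C.to (C.unitorʳ A)) ≈ to (D.unitorʳ (F₀ A))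
    μ-braiding : ∀ A B →
      to (μ A B) ⨾ F₁ (C.braiding A B) ≈ D.braiding (F₀ A) (F₀ B) ⨾ to (μ B A)

    F-copy : ∀ A → F₁ (C.copy A) ≈ D.copy (F₀ A) ⨾ to (μ A A)
    F-del  : ∀ A → F₁ (C.del A) ≈ D.del (F₀ A) ⨾ to ε

-- A monoidal natural isomorphism from the identity functor to the composite
-- of F followed by G whose components respect copy and del.  The comparison
-- maps of the composite are G.ε ⨾ G₁ F.ε and G.μ ⨾ G₁ F.μ.

record MarkovUnitIso {o h e o′ h′ e′ : Level}
                     {𝒞 : MarkovCategory o h e} {𝒟 : MarkovCategory o′ h′ e′}
                     (F : MarkovFunctor 𝒞 𝒟) (G : MarkovFunctor 𝒟 𝒞) :
                     Set (o ⊔ h ⊔ e) where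
  private
    module D = MarkovCategory 𝒟
    module F = MarkovFunctor F
    module G = MarkovFunctor G
  open MarkovCategory 𝒞

  GF₀ : Obj → Obj
  GF₀ A = G.F₀ (F.F₀ A)

  GF-ε : Hom unit (GF₀ unit)
  GF-ε = to G.ε ⨾ G.F₁ (D.to F.ε)

  GF-μ : ∀ A B → Hom (GF₀ A ⊗₀ GF₀ B) (GF₀ (A ⊗₀ B))
  GF-μ A B = to (G.μ (F.F₀ A) (F.F₀ B)) ⨾ G.F₁ (D.to (F.μ A B))

  field
    η         : ∀ A → A ≅ GF₀ A
    η-natural : ∀ {A B} (f : Hom A B) → f ⨾ to (η B) ≈ to (η A) ⨾ G.F₁ (F.F₁ f)
    η-unit    : to (η unit) ≈ GF-ε
    η-⊗       : ∀ A B → to (η (A ⊗₀ B)) ≈ (to (η A) ⊗₁ to (η B)) ⨾ GF-μ A B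
    η-copy    : ∀ A → to (η A) ⨾ copy (GF₀ A) ≈ copy A ⨾ (to (η A) ⊗₁ to (η A))
    η-del     : ∀ A → to (η A) ⨾ del (GF₀ A) ≈ del A

record MarkovEquivalence {o h e o′ h′ e′ : Level}
                         (𝒞 : MarkovCategory o h e) (𝒟 : MarkovCategory o′ h′ e′) :
                         Set (o ⊔ h ⊔ e ⊔ o′ ⊔ h′ ⊔ e′) where
  field
    functor  : MarkovFunctor 𝒞 𝒟
    inverse  : MarkovFunctor 𝒟 𝒞
    unitIso  : MarkovUnitIso functor inverse
    counitIso : MarkovUnitIso inverse functor

-- The library has no real numbers, so ℝ is given by its axiomatic
-- characterisation as a Dedekind-complete ordered field.

record RealNumbers : Set₁ where
  infix  4 _≈ʳ_ _≤ʳ_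
  infixl 6 _+ʳ_
  infixl 7 _*ʳ_
  infix  8 -ʳ_
  field
    Carrier : Set
    _≈ʳ_    : Rel Carrier 0ℓ
    _≤ʳ_    : Rel Carrier 0ℓ
    _+ʳ_    : Carrier → Carrier → Carrier
    _*ʳ_    : Carrier → Carrier → Carrier
    -ʳ_     : Carrier → Carrier
    0ʳ      : Carrier
    1ʳ      : Carrier

    isCommutativeRing : IsCommutativeRing _≈ʳ_ _+ʳ_ _*ʳ_ -ʳ_ 0ʳ 1ʳ
    0≉1               : ¬ (0ʳ ≈ʳ 1ʳ)
    invertible        : ∀ x → ¬ (x ≈ʳ 0ʳ) → ∃[ y ] x *ʳ y ≈ʳ 1ʳ

    isTotalOrder : IsTotalOrder _≈ʳ_ _≤ʳ_
    +-mono-≤     : ∀ {x y} z → x ≤ʳ y → (x +ʳ z) ≤ʳ (y +ʳ z)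
    *-nonNeg     : ∀ {x y} → 0ʳ ≤ʳ x → 0ʳ ≤ʳ y → 0ʳ ≤ʳ (x *ʳ y)

  IsUpperBound : Pred Carrier 0ℓ → Carrier → Set
  IsUpperBound S b = ∀ x → S x → x ≤ʳ b

  field
    supremum : ∀ (S : Pred Carrier 0ℓ) → Satisfiable S → ∃ (IsUpperBound S) →
               ∃[ s ] IsUpperBound S s × (∀ b → IsUpperBound S b → s ≤ʳ b)

  commutativeRing : CommutativeRing 0ℓ 0ℓ
  commutativeRing = record { isCommutativeRing = isCommutativeRing }

module Linear (ℝ : RealNumbers) where

  open RealNumbers ℝ using (Carrier; _≈ʳ_; _+ʳ_; _*ʳ_; -ʳ_; 0ʳ; 1ʳ; commutativeRing)
  private
    module R = CommutativeRing commutativeRing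
    module RP = RingProperties R.ring
    module R+ = CommutativeSemigroupProperties R.+-commutativeSemigroup
  open VecEquality R.setoid public using (_≋_; ≋-refl; ≋-sym; ≋-trans)

  infixl 6 _⊕_
  infixr 7 _·_
  infix  8 ⊖_

  _⊕_ : ∀ {n} → Vector Carrier n → Vector Carrier n → Vector Carrier n
  _⊕_ = zipWith _+ʳ_

  𝟎 : ∀ {n} → Vector Carrier n
  𝟎 {n} = replicate n 0ʳ

  ⊖_ : ∀ {n} → Vector Carrier n → Vector Carrier n
  ⊖_ = map -ʳ_

  _·_ : ∀ {n} → Carrier → Vector Carrier n → Vector Carrier n
  c · x = map (c *ʳ_) x

  ⊕-cong : ∀ {n} {x x′ y y′ : Vector Carrier n} → x ≋ x′ → y ≋ y′ → x ⊕ y ≋ x′ ⊕ y′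
  ⊕-cong p q i = R.+-cong (p i) (q i)

  ·-cong : ∀ {n} c {x y : Vector Carrier n} → x ≋ y → c · x ≋ c · y
  ·-cong c p i = R.*-congˡ (p i)

  ℝ^_ : ℕ → LeftModule R.ring 0ℓ 0ℓ
  ℝ^ n = record
    { Carrierᴹ = Vector Carrier n
    ; _≈ᴹ_ = _≋_
    ; _+ᴹ_ = _⊕_
    ; _*ₗ_ = _·_
    ; 0ᴹ   = 𝟎
    ; -ᴹ_  = ⊖_
    ; isLeftModule = record
      { isLeftSemimodule = record
        { +ᴹ-isCommutativeMonoid =
            Pointwise.isCommutativeMonoid (Fin n) R.+-isCommutativeMonoid
        ; isPreleftSemimodule = record
          { *ₗ-cong      = λ c≈d x≋y i → R.*-cong c≈d (x≋y i)
          ; *ₗ-zeroˡ     = λ x i → R.zeroˡ (x i)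
          ; *ₗ-distribʳ  = λ x c d i → R.distribʳ (x i) c d
          ; *ₗ-identityˡ = λ x i → R.*-identityˡ (x i)
          ; *ₗ-assoc     = λ c d x i → R.*-assoc c d (x i)
          ; *ₗ-zeroʳ     = λ c i → R.zeroʳ c
          ; *ₗ-distribˡ  = λ c x y i → R.distribˡ c (x i) (y i)
          }
        }
      ; -ᴹ‿cong    = λ x≋y i → R.-‿cong (x≋y i)
      ; -ᴹ‿inverse = (λ x i → R.-‿inverseˡ (x i)) , (λ x i → R.-‿inverseʳ (x i))
      }
    }

  infixr 5 _⊸_
  record _⊸_ (m n : ℕ) : Set where
    no-eta-equality
    infixl 10 _$_
    field
      _$_      : Vector Carrier m → Vector Carrier n
      isLinear : IsLeftModuleHomomorphism (LeftModule.rawLeftModule (ℝ^ m))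
                                          (LeftModule.rawLeftModule (ℝ^ n)) _$_
    open IsLeftModuleHomomorphism isLinear public
      using () renaming
      (⟦⟧-cong to $-cong; +ᴹ-homo to $-⊕; 0ᴹ-homo to $-𝟎; -ᴹ-homo to $-⊖; *ₗ-homo to $-·)

  open _⊸_ public

  -- The remaining homomorphism axioms follow from additivity.

  linear : ∀ {m n} {f : Vector Carrier m → Vector Carrier n} →
           (∀ {x y} → x ≋ y → f x ≋ f y) →
           (∀ x y → f (x ⊕ y) ≋ f x ⊕ f y) →
           (∀ c x → f (c · x) ≋ c · f x) →
           IsLeftModuleHomomorphism (LeftModule.rawLeftModule (ℝ^ m))
                                    (LeftModule.rawLeftModule (ℝ^ n)) f
  linear {f = f} cong add scale = record
    { +ᴹ-isGroupHomomorphism = record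
      { isMonoidHomomorphism = record
        { isMagmaHomomorphism = record
          { isRelHomomorphism = record { cong = cong }
          ; homo = add
          }
        ; ε-homo = f𝟎
        }
      ; ⁻¹-homo = f⊖
      }
    ; *ₗ-homo = scale
    }
    where
    f𝟎 : f 𝟎 ≋ 𝟎
    f𝟎 i = RP.x+x≈x⇒x≈0 (f 𝟎 i)
      (R.trans (R.sym (add 𝟎 𝟎 i)) (cong (λ _ → R.+-identityˡ 0ʳ) i))

    f⊖ : ∀ x → f (⊖ x) ≋ ⊖ f x
    f⊖ x i = RP.+-inverseˡ-unique (f (⊖ x) i) (f x i)
      (R.trans (R.sym (add (⊖ x) x i))
               (R.trans (cong (λ j → R.-‿inverseˡ (x j)) i) (f𝟎 i)))

  infix 4 _≗_
  _≗_ : ∀ {m n} → Rel (m ⊸ n) 0ℓ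
  f ≗ g = ∀ x → f $ x ≋ g $ x

  idₗ : ∀ {n} → n ⊸ n
  idₗ $ x = x
  isLinear idₗ = linear (λ x≋y → x≋y) (λ _ _ → ≋-refl) (λ _ _ → ≋-refl)

  infixl 9 _⨾ₗ_
  _⨾ₗ_ : ∀ {l m n} → l ⊸ m → m ⊸ n → l ⊸ n
  (f ⨾ₗ g) $ x = g $ (f $ x)
  isLinear (f ⨾ₗ g) = linear
    (λ x≋y → $-cong g ($-cong f x≋y))
    (λ x y → ≋-trans ($-cong g ($-⊕ f x y)) ($-⊕ g (f $ x) (f $ y)))
    (λ c x → ≋-trans ($-cong g ($-· f c x)) ($-· g c (f $ x)))

  -- The object n stands for the space ℝⁿ.

  Vec : Category 0ℓ 0ℓ 0ℓ
  Vec = record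
    { Obj = ℕ
    ; Hom = _⊸_
    ; _≈_ = _≗_
    ; id  = idₗ
    ; _⨾_ = _⨾ₗ_
    ; isEquivalence = record
      { refl  = λ _ → ≋-refl
      ; sym   = λ f≗g x → ≋-sym (f≗g x)
      ; trans = λ f≗g g≗h x → ≋-trans (f≗g x) (g≗h x)
      }
    ; ⨾-cong    = λ {_} {_} {_} {f} {f′} {g} f≗f′ g≗g′ x →
                    ≋-trans ($-cong g (f≗f′ x)) (g≗g′ (f′ $ x))
    ; identityˡ = λ _ _ → ≋-refl
    ; identityʳ = λ _ _ → ≋-refl
    ; assoc     = λ _ _ _ _ → ≋-refl
    }

  -- ℝᵐ × ℝⁿ is ℝᵐ⁺ⁿ with projections take and drop and pairing _++_.

  take-++ : ∀ {m n} (x : Vector Carrier m) (y : Vector Carrier n) → take m (x ++ y) ≋ x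
  take-++ {m} {n} x y i rewrite splitAt-↑ˡ m i n = R.refl

  drop-++ : ∀ {m n} (x : Vector Carrier m) (y : Vector Carrier n) → drop m (x ++ y) ≋ y
  drop-++ {m} {n} x y i rewrite splitAt-↑ʳ m n i = R.refl

  ++-cong : ∀ {m n} {x x′ : Vector Carrier m} {y y′ : Vector Carrier n} →
            x ≋ x′ → y ≋ y′ → x ++ y ≋ x′ ++ y′
  ++-cong = PointwiseProperties.++⁺ _≈ʳ_

  take-drop : ∀ m {n} {x y : Vector Carrier (m + n)} →
              take m x ≋ take m y → drop m x ≋ drop m y → x ≋ y
  take-drop zero    _ d i       = d i
  take-drop (suc m) t d zero    = t zero
  take-drop (suc m) {n} {x} {y} t d (suc i) =
    take-drop m {n} {tail x} {tail y} (λ j → t (suc j)) d i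

  fst : ∀ m n → (m + n) ⊸ m
  fst m n $ x = take m x
  isLinear (fst m n) = linear (λ x≋y i → x≋y (i ↑ˡ n)) (λ _ _ → ≋-refl) (λ _ _ → ≋-refl)

  snd : ∀ m n → (m + n) ⊸ n
  snd m n $ x = drop m x
  isLinear (snd m n) = linear (λ x≋y i → x≋y (m ↑ʳ i)) (λ _ _ → ≋-refl) (λ _ _ → ≋-refl)

  ⟨_,_⟩ : ∀ {l m n} → l ⊸ m → l ⊸ n → l ⊸ (m + n)
  ⟨ f , g ⟩ $ x = (f $ x) ++ (g $ x)
  isLinear (⟨_,_⟩ {m = m} f g) = linear cong add scale
    where
    cong : ∀ {x y} → x ≋ y → (f $ x) ++ (g $ x) ≋ (f $ y) ++ (g $ y)
    cong x≋y i with splitAt m i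
    ... | inj₁ j = $-cong f x≋y j
    ... | inj₂ j = $-cong g x≋y j

    add : ∀ x y → (f $ (x ⊕ y)) ++ (g $ (x ⊕ y)) ≋ ((f $ x) ++ (g $ x)) ⊕ ((f $ y) ++ (g $ y))
    add x y i with splitAt m i
    ... | inj₁ j = $-⊕ f x y j
    ... | inj₂ j = $-⊕ g x y j

    scale : ∀ c x → (f $ (c · x)) ++ (g $ (c · x)) ≋ c · ((f $ x) ++ (g $ x))
    scale c x i with splitAt m i
    ... | inj₁ j = $-· f c x j
    ... | inj₂ j = $-· g c x j

  !ₗ : ∀ {n} → n ⊸ 0
  !ₗ $ x = []
  isLinear !ₗ = linear (λ _ ()) (λ _ _ ()) (λ _ _ ())

  zeroₗ : ∀ {m n} → m ⊸ n
  zeroₗ $ x = 𝟎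
  isLinear zeroₗ = linear (λ _ → ≋-refl) (λ _ _ _ → R.sym (R.+-identityˡ 0ʳ))
                          (λ c _ _ → R.sym (R.zeroʳ c))

  infixr 10 _⊗ₗ_
  _⊗ₗ_ : ∀ {m n m′ n′} → m ⊸ m′ → n ⊸ n′ → (m + n) ⊸ (m′ + n′)
  _⊗ₗ_ {m} {n} f g = ⟨ fst m n ⨾ₗ f , snd m n ⨾ₗ g ⟩

  assocₗ : ∀ l m n → ((l + m) + n) ⊸ (l + (m + n))
  assocₗ l m n = ⟨ fst (l + m) n ⨾ₗ fst l m , ⟨ fst (l + m) n ⨾ₗ snd l m , snd (l + m) n ⟩ ⟩

  assocₗ⁻¹ : ∀ l m n → (l + (m + n)) ⊸ ((l + m) + n)
  assocₗ⁻¹ l m n = ⟨ ⟨ fst l (m + n) , snd l (m + n) ⨾ₗ fst m n ⟩ , snd l (m + n) ⨾ₗ snd m n ⟩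

  unitˡₗ : ∀ n → (0 + n) ⊸ n
  unitˡₗ n = snd 0 n

  unitˡₗ⁻¹ : ∀ n → n ⊸ (0 + n)
  unitˡₗ⁻¹ n = ⟨ !ₗ , idₗ ⟩

  unitʳₗ : ∀ n → (n + 0) ⊸ n
  unitʳₗ n = fst n 0

  unitʳₗ⁻¹ : ∀ n → n ⊸ (n + 0)
  unitʳₗ⁻¹ n = ⟨ idₗ , !ₗ ⟩

  swapₗ : ∀ m n → (m + n) ⊸ (n + m)
  swapₗ m n = ⟨ snd m n , fst m n ⟩

  diagₗ : ∀ n → n ⊸ (n + n)
  diagₗ n = ⟨ idₗ , idₗ ⟩

module LinearRelations (ℝ : RealNumbers) where

  open RealNumbers ℝ using (Carrier)
  open Linear ℝ

  record TotalLinearRelation (m n : ℕ) : Set₁ where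
    no-eta-equality
    field
      rel     : REL (Vector Carrier m) (Vector Carrier n) 0ℓ
      resp    : ∀ {x x′ y y′} → x ≋ x′ → y ≋ y′ → rel x y → rel x′ y′
      rel-𝟎   : rel 𝟎 𝟎
      rel-⊕   : ∀ {x x′ y y′} → rel x y → rel x′ y′ → rel (x ⊕ x′) (y ⊕ y′)
      rel-·   : ∀ c {x y} → rel x y → rel (c · x) (c · y)
      total   : ∀ x → ∃[ y ] rel x y

  open TotalLinearRelation public

  -- A record, so that the two relations can be inferred from the type of a proof.

  infix 4 _≈ᴿ_
  record _≈ᴿ_ {m n} (R S : TotalLinearRelation m n) : Set where
    constructor mk≈ᴿ
    field
      rel-⇔ : rel R ⇔ rel S

  open _≈ᴿ_ public

  ≈ᴿ-isEquivalence : ∀ {m n} → IsEquivalence (_≈ᴿ_ {m} {n})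
  ≈ᴿ-isEquivalence = record
    { refl  = mk≈ᴿ ((λ r → r) , (λ r → r))
    ; sym   = λ { (mk≈ᴿ (f , g)) → mk≈ᴿ (g , f) }
    ; trans = λ { (mk≈ᴿ (f , g)) (mk≈ᴿ (f′ , g′)) → mk≈ᴿ ((λ r → f′ (f r)) , (λ r → g (g′ r))) }
    }

  graph : ∀ {m n} → m ⊸ n → TotalLinearRelation m n
  rel   (graph f) x y = f $ x ≋ y
  resp  (graph f) x≋x′ y≋y′ fx≋y = ≋-trans ($-cong f (≋-sym x≋x′)) (≋-trans fx≋y y≋y′)
  rel-𝟎 (graph f) = $-𝟎 f
  rel-⊕ (graph f) {x} {x′} p q = ≋-trans ($-⊕ f x x′) (⊕-cong p q)
  rel-· (graph f) c {x} p = ≋-trans ($-· f c x) (·-cong c p)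
  total (graph f) x = f $ x , ≋-refl

  idᴿ : ∀ {n} → TotalLinearRelation n n
  idᴿ = graph idₗ

  infixl 9 _⨾ᴿ_
  _⨾ᴿ_ : ∀ {l m n} → TotalLinearRelation l m → TotalLinearRelation m n → TotalLinearRelation l n
  rel   (R ⨾ᴿ S) x z = ∃[ y ] rel R x y × rel S y z
  resp  (R ⨾ᴿ S) p q (y , r , s) = y , resp R p ≋-refl r , resp S ≋-refl q s
  rel-𝟎 (R ⨾ᴿ S) = 𝟎 , rel-𝟎 R , rel-𝟎 S
  rel-⊕ (R ⨾ᴿ S) (y , r , s) (y′ , r′ , s′) = y ⊕ y′ , rel-⊕ R r r′ , rel-⊕ S s s′
  rel-· (R ⨾ᴿ S) c (y , r , s) = c · y , rel-· R c r , rel-· S c s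
  total (R ⨾ᴿ S) x = let (y , r) = total R x; (z , s) = total S y in z , y , r , s

  infixr 10 _⊗ᴿ_
  _⊗ᴿ_ : ∀ {m n m′ n′} → TotalLinearRelation m m′ → TotalLinearRelation n n′ →
         TotalLinearRelation (m + n) (m′ + n′)
  rel   (_⊗ᴿ_ {m} {n} {m′} {n′} R S) x y = rel R (take m x) (take m′ y) × rel S (drop m x) (drop m′ y)
  resp  (_⊗ᴿ_ {m} {n} {m′} {n′} R S) p q (r , s) =
    resp R ($-cong (fst m n) p) ($-cong (fst m′ n′) q) r ,
    resp S ($-cong (snd m n) p) ($-cong (snd m′ n′) q) s
  rel-𝟎 (R ⊗ᴿ S) = rel-𝟎 R , rel-𝟎 S
  rel-⊕ (R ⊗ᴿ S) (r , s) (r′ , s′) = rel-⊕ R r r′ , rel-⊕ S s s′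
  rel-· (R ⊗ᴿ S) c (r , s) = rel-· R c r , rel-· S c s
  total (_⊗ᴿ_ {m} {n} R S) x =
    let (y , r) = total R (take m x); (z , s) = total S (drop m x) in
    y ++ z , resp R ≋-refl (≋-sym (take-++ y z)) r , resp S ≋-refl (≋-sym (drop-++ y z)) s

  ⨾ᴿ-cong : ∀ {l m n} {R R′ : TotalLinearRelation l m} {S S′ : TotalLinearRelation m n} →
            R ≈ᴿ R′ → S ≈ᴿ S′ → R ⨾ᴿ S ≈ᴿ R′ ⨾ᴿ S′
  ⨾ᴿ-cong (mk≈ᴿ (f , f⁻¹)) (mk≈ᴿ (g , g⁻¹)) =
    mk≈ᴿ ((λ { (y , r , s) → y , f r , g s }) , (λ { (y , r , s) → y , f⁻¹ r , g⁻¹ s }))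

  ⊗ᴿ-cong : ∀ {m n m′ n′} {R R′ : TotalLinearRelation m m′} {S S′ : TotalLinearRelation n n′} →
            R ≈ᴿ R′ → S ≈ᴿ S′ → R ⊗ᴿ S ≈ᴿ R′ ⊗ᴿ S′
  ⊗ᴿ-cong (mk≈ᴿ (f , f⁻¹)) (mk≈ᴿ (g , g⁻¹)) =
    mk≈ᴿ ((λ { (r , s) → f r , g s }) , (λ { (r , s) → f⁻¹ r , g⁻¹ s }))

  -- Coherence laws are checked on iterated pairs of vectors, where they hold
  -- definitionally, rather than on concatenated vectors.

  private
    infixr 9 _⊗_
    data Shape : Set where
      leaf : ℕ → Shape
      ∅    : Shape
      _⊗_  : Shape → Shape → Shape

    dim : Shape → ℕ
    dim (leaf n) = n
    dim ∅        = 0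
    dim (S ⊗ T)  = dim S + dim T

    El : Shape → Set
    El (leaf n) = Vector Carrier n
    El ∅        = ⊤
    El (S ⊗ T)  = El S × El T

    pack : ∀ S → El S → Vector Carrier (dim S)
    pack (leaf n) x       = x
    pack ∅        tt      = []
    pack (S ⊗ T)  (a , b) = pack S a ++ pack T b

    unpack : ∀ S → Vector Carrier (dim S) → El S
    unpack (leaf n) x = x
    unpack ∅        _ = tt
    unpack (S ⊗ T)  x = unpack S (take (dim S) x) , unpack T (drop (dim S) x)

    pack-unpack : ∀ S x → pack S (unpack S x) ≋ x
    pack-unpack (leaf n) x = ≋-refl
    pack-unpack ∅        x ()
    pack-unpack (S ⊗ T)  x = take-drop (dim S)
      (≋-trans (take-++ (pack S a) (pack T b)) (pack-unpack S _))
      (≋-trans (drop-++ (pack S a) (pack T b)) (pack-unpack T _))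
      where
      a = unpack S (take (dim S) x)
      b = unpack T (drop (dim S) x)

    record Evaluates (S T : Shape) (f : dim S ⊸ dim T) (g : El S → El T) : Set where
      constructor evaluates
      field
        on-pack : ∀ e → f $ pack S e ≋ pack T (g e)
    open Evaluates

    id↓ : ∀ S → Evaluates S S idₗ (λ e → e)
    id↓ S = evaluates λ _ → ≋-refl

    fst↓ : ∀ S T → Evaluates (S ⊗ T) S (fst (dim S) (dim T)) proj₁
    fst↓ S T = evaluates λ (a , b) → take-++ (pack S a) (pack T b)

    snd↓ : ∀ S T → Evaluates (S ⊗ T) T (snd (dim S) (dim T)) proj₂
    snd↓ S T = evaluates λ (a , b) → drop-++ (pack S a) (pack T b)

    !↓ : ∀ S → Evaluates S ∅ !ₗ (λ _ → tt)
    !↓ S = evaluates λ _ ()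

    pair↓ : ∀ {S T U f f′ g g′} → Evaluates S T f g → Evaluates S U f′ g′ →
            Evaluates S (T ⊗ U) ⟨ f , f′ ⟩ (λ e → g e , g′ e)
    pair↓ p q = evaluates λ e → ++-cong (on-pack p e) (on-pack q e)

    _⨾↓_ : ∀ {S T U f f′ g g′} → Evaluates S T f g → Evaluates T U f′ g′ →
           Evaluates S U (f ⨾ₗ f′) (λ e → g′ (g e))
    _⨾↓_ {f′ = f′} {g} p q = evaluates λ e → ≋-trans ($-cong f′ (on-pack p e)) (on-pack q (g e))

    assoc↓ : ∀ S T U → Evaluates ((S ⊗ T) ⊗ U) (S ⊗ T ⊗ U) (assocₗ (dim S) (dim T) (dim U))
                                 (λ ((a , b) , c) → a , b , c)
    assoc↓ S T U = pair↓ (fst↓ (S ⊗ T) U ⨾↓ fst↓ S T)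
                         (pair↓ (fst↓ (S ⊗ T) U ⨾↓ snd↓ S T) (snd↓ (S ⊗ T) U))

    assoc⁻¹↓ : ∀ S T U → Evaluates (S ⊗ T ⊗ U) ((S ⊗ T) ⊗ U) (assocₗ⁻¹ (dim S) (dim T) (dim U))
                                   (λ (a , b , c) → (a , b) , c)
    assoc⁻¹↓ S T U = pair↓ (pair↓ (fst↓ S (T ⊗ U)) (snd↓ S (T ⊗ U) ⨾↓ fst↓ T U))
                           (snd↓ S (T ⊗ U) ⨾↓ snd↓ T U)

    unitˡ↓ : ∀ S → Evaluates (∅ ⊗ S) S (unitˡₗ (dim S)) proj₂
    unitˡ↓ S = snd↓ ∅ S

    unitˡ⁻¹↓ : ∀ S → Evaluates S (∅ ⊗ S) (unitˡₗ⁻¹ (dim S)) (λ e → tt , e)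
    unitˡ⁻¹↓ S = pair↓ (!↓ S) (id↓ S)

    unitʳ↓ : ∀ S → Evaluates (S ⊗ ∅) S (unitʳₗ (dim S)) proj₁
    unitʳ↓ S = fst↓ S ∅

    unitʳ⁻¹↓ : ∀ S → Evaluates S (S ⊗ ∅) (unitʳₗ⁻¹ (dim S)) (λ e → e , tt)
    unitʳ⁻¹↓ S = pair↓ (id↓ S) (!↓ S)

    swap↓ : ∀ S T → Evaluates (S ⊗ T) (T ⊗ S) (swapₗ (dim S) (dim T)) (λ (a , b) → b , a)
    swap↓ S T = pair↓ (snd↓ S T) (fst↓ S T)

    diag↓ : ∀ S → Evaluates S (S ⊗ S) (diagₗ (dim S)) (λ e → e , e)
    diag↓ S = pair↓ (id↓ S) (id↓ S)

    same : ∀ S T {f f′ g} → Evaluates S T f g → Evaluates S T f′ g → f ≗ f′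
    same S T {f} {f′} p q x =
      ≋-trans ($-cong f (≋-sym (pack-unpack S x)))
      (≋-trans (on-pack p (unpack S x))
      (≋-trans (≋-sym (on-pack q (unpack S x))) ($-cong f′ (pack-unpack S x))))

    record Computes (S T : Shape) (R : TotalLinearRelation (dim S) (dim T)) (g : El S → El T) : Set where
      constructor computes
      field
        sound    : ∀ {e y} → rel R (pack S e) y → pack T (g e) ≋ y
        complete : ∀ e → rel R (pack S e) (pack T (g e))
    open Computes

    sameᴿ : ∀ S T {R R′ g} → Computes S T R g → Computes S T R′ g → R ≈ᴿ R′
    sameᴿ S T {R} {R′} p q = mk≈ᴿ (go {R} {R′} p q , go {R′} {R} q p)
      where
      go : ∀ {R R′ g} → Computes S T R g → Computes S T R′ g → ∀ {x y} → rel R x y → rel R′ x y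
      go {R} {R′} p q {x} r =
        resp R′ (pack-unpack S x) (sound p (resp R (≋-sym (pack-unpack S x)) ≋-refl r))
             (complete q (unpack S x))

    graph⇓ : ∀ {S T f g} → Evaluates S T f g → Computes S T (graph f) g
    graph⇓ p = computes (λ {e} r → ≋-trans (≋-sym (on-pack p e)) r) (on-pack p)

    id⇓ : ∀ S → Computes S S idᴿ (λ e → e)
    id⇓ S = graph⇓ (id↓ S)

    infixl 9 _⨾⇓_
    _⨾⇓_ : ∀ {S T U R R′ g g′} → Computes S T R g → Computes T U R′ g′ →
           Computes S U (R ⨾ᴿ R′) (λ e → g′ (g e))
    _⨾⇓_ {T = T} {R′ = R′} {g = g} p q = computes
      (λ { (y , r , s) → sound q (resp R′ (≋-sym (sound p r)) ≋-refl s) })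
      (λ e → pack T (g e) , complete p e , complete q (g e))

    infixr 10 _⊗⇓_
    _⊗⇓_ : ∀ {S T S′ T′ R R′ g g′} → Computes S S′ R g → Computes T T′ R′ g′ →
           Computes (S ⊗ T) (S′ ⊗ T′) (R ⊗ᴿ R′) (λ (a , b) → g a , g′ b)
    _⊗⇓_ {S} {T} {S′} {T′} {R} {R′} {g} {g′} p q = computes
      (λ { {a , b} (r , s) → take-drop (dim S′)
         (≋-trans (take-++ (pack S′ (g a)) (pack T′ (g′ b)))
                  (sound p (resp R (take-++ (pack S a) (pack T b)) ≋-refl r)))
         (≋-trans (drop-++ (pack S′ (g a)) (pack T′ (g′ b)))
                  (sound q (resp R′ (drop-++ (pack S a) (pack T b)) ≋-refl s))) })
      (λ { (a , b) →
           resp R (≋-sym (take-++ (pack S a) (pack T b)))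
                  (≋-sym (take-++ (pack S′ (g a)) (pack T′ (g′ b)))) (complete p a)
         , resp R′ (≋-sym (drop-++ (pack S a) (pack T b)))
                   (≋-sym (drop-++ (pack S′ (g a)) (pack T′ (g′ b)))) (complete q b) })

    natural : ∀ {m n m′ n′} (R : TotalLinearRelation m m′) (R′ : TotalLinearRelation n n′)
              (f : m ⊸ n) (f′ : m′ ⊸ n′) (f′⁻¹ : n′ ⊸ m′) → f′⁻¹ ⨾ₗ f′ ≗ idₗ →
              (∀ {x y} → rel R x y → rel R′ (f $ x) (f′ $ y)) →
              (∀ {x z} → rel R′ (f $ x) z → rel R x (f′⁻¹ $ z)) →
              R ⨾ᴿ graph f′ ≈ᴿ graph f ⨾ᴿ R′
    natural R R′ f f′ f′⁻¹ sec fwd bwd = mk≈ᴿ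
      ( (λ { {x} (y , r , f′y≋z) → f $ x , ≋-refl , resp R′ ≋-refl f′y≋z (fwd r) })
      , (λ { {x} {z} (w , fx≋w , r) →
             f′⁻¹ $ z , bwd (resp R′ (≋-sym fx≋w) ≋-refl r) , sec z }) )

    module _ (l m n : ℕ) where

      assoc₁ : ∀ x → take l (assocₗ l m n $ x) ≋ take l (take (l + m) x)
      assoc₁ x = take-++ (take l (take (l + m) x)) _

      assoc₂ : ∀ x → take m (drop l (assocₗ l m n $ x)) ≋ drop l (take (l + m) x)
      assoc₂ x = ≋-trans ($-cong (fst m n) (drop-++ (take l (take (l + m) x)) _))
                         (take-++ (drop l (take (l + m) x)) _)

      assoc₃ : ∀ x → drop m (drop l (assocₗ l m n $ x)) ≋ drop (l + m) x
      assoc₃ x = ≋-trans ($-cong (snd m n) (drop-++ (take l (take (l + m) x)) _))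
                         (drop-++ (drop l (take (l + m) x)) _)

      assoc⁻¹₁ : ∀ x → take l (take (l + m) (assocₗ⁻¹ l m n $ x)) ≋ take l x
      assoc⁻¹₁ x = ≋-trans ($-cong (fst l m) (take-++ (take l x ++ take m (drop l x)) _))
                           (take-++ (take l x) _)

      assoc⁻¹₂ : ∀ x → drop l (take (l + m) (assocₗ⁻¹ l m n $ x)) ≋ take m (drop l x)
      assoc⁻¹₂ x = ≋-trans ($-cong (snd l m) (take-++ (take l x ++ take m (drop l x)) _))
                           (drop-++ (take l x) _)

      assoc⁻¹₃ : ∀ x → drop (l + m) (assocₗ⁻¹ l m n $ x) ≋ drop m (drop l x)
      assoc⁻¹₃ x = drop-++ (take l x ++ take m (drop l x)) _

    assocᴿ-natural : ∀ {l m n l′ m′ n′} (R : TotalLinearRelation l l′)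
      (S : TotalLinearRelation m m′) (T : TotalLinearRelation n n′) →
      ((R ⊗ᴿ S) ⊗ᴿ T) ⨾ᴿ graph (assocₗ l′ m′ n′) ≈ᴿ graph (assocₗ l m n) ⨾ᴿ (R ⊗ᴿ (S ⊗ᴿ T))
    assocᴿ-natural {l} {m} {n} {l′} {m′} {n′} R S T =
      natural ((R ⊗ᴿ S) ⊗ᴿ T) (R ⊗ᴿ (S ⊗ᴿ T)) (assocₗ l m n) (assocₗ l′ m′ n′) (assocₗ⁻¹ l′ m′ n′)
        (same (A ⊗ B ⊗ C) (A ⊗ B ⊗ C) (assoc⁻¹↓ A B C ⨾↓ assoc↓ A B C) (id↓ (A ⊗ B ⊗ C)))
        (λ { {x} {y} ((r , s) , t) →
             resp R (≋-sym (assoc₁ l m n x)) (≋-sym (assoc₁ l′ m′ n′ y)) r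
           , resp S (≋-sym (assoc₂ l m n x)) (≋-sym (assoc₂ l′ m′ n′ y)) s
           , resp T (≋-sym (assoc₃ l m n x)) (≋-sym (assoc₃ l′ m′ n′ y)) t })
        (λ { {x} {z} (r , s , t) →
             ( resp R (assoc₁ l m n x) (≋-sym (assoc⁻¹₁ l′ m′ n′ z)) r
             , resp S (assoc₂ l m n x) (≋-sym (assoc⁻¹₂ l′ m′ n′ z)) s )
           , resp T (assoc₃ l m n x) (≋-sym (assoc⁻¹₃ l′ m′ n′ z)) t })
      where
      A = leaf l′
      B = leaf m′
      C = leaf n′

    unitˡᴿ-natural : ∀ {n n′} (R : TotalLinearRelation n n′) →
      (idᴿ {0} ⊗ᴿ R) ⨾ᴿ graph (unitˡₗ n′) ≈ᴿ graph (unitˡₗ n) ⨾ᴿ R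
    unitˡᴿ-natural {n} {n′} R =
      natural (idᴿ {0} ⊗ᴿ R) R (unitˡₗ n) (unitˡₗ n′) (unitˡₗ⁻¹ n′)
        (same A A (unitˡ⁻¹↓ A ⨾↓ unitˡ↓ A) (id↓ A))
        proj₂
        (λ { {x} {z} r → (λ ()) , resp R ≋-refl (≋-sym (drop-++ [] z)) r })
      where A = leaf n′

    unitʳᴿ-natural : ∀ {n n′} (R : TotalLinearRelation n n′) →
      (R ⊗ᴿ idᴿ {0}) ⨾ᴿ graph (unitʳₗ n′) ≈ᴿ graph (unitʳₗ n) ⨾ᴿ R
    unitʳᴿ-natural {n} {n′} R =
      natural (R ⊗ᴿ idᴿ {0}) R (unitʳₗ n) (unitʳₗ n′) (unitʳₗ⁻¹ n′)
        (same A A (unitʳ⁻¹↓ A ⨾↓ unitʳ↓ A) (id↓ A))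
        proj₁
        (λ { {x} {z} r → resp R ≋-refl (≋-sym (take-++ z [])) r , (λ ()) })
      where A = leaf n′

    swapᴿ-natural : ∀ {m n m′ n′} (R : TotalLinearRelation m m′) (S : TotalLinearRelation n n′) →
      (R ⊗ᴿ S) ⨾ᴿ graph (swapₗ m′ n′) ≈ᴿ graph (swapₗ m n) ⨾ᴿ (S ⊗ᴿ R)
    swapᴿ-natural {m} {n} {m′} {n′} R S =
      natural (R ⊗ᴿ S) (S ⊗ᴿ R) (swapₗ m n) (swapₗ m′ n′) (swapₗ n′ m′)
        (same (B ⊗ A) (B ⊗ A) (swap↓ B A ⨾↓ swap↓ A B) (id↓ (B ⊗ A)))
        (λ { {x} {y} (r , s) →
             resp S (≋-sym (take-++ (drop m x) _)) (≋-sym (take-++ (drop m′ y) _)) s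
           , resp R (≋-sym (drop-++ (drop m x) _)) (≋-sym (drop-++ (drop m′ y) _)) r })
        (λ { {x} {z} (s , r) →
             resp R (drop-++ (drop m x) _) (≋-sym (take-++ (drop n′ z) _)) r
           , resp S (take-++ (drop m x) _) (≋-sym (drop-++ (drop n′ z) _)) s })
      where
      A = leaf m′
      B = leaf n′

    ⊗ᴿ-⨾ᴿ : ∀ {l m n l′ m′ n′} (R : TotalLinearRelation l m) (S : TotalLinearRelation m n)
      (R′ : TotalLinearRelation l′ m′) (S′ : TotalLinearRelation m′ n′) →
      (R ⨾ᴿ S) ⊗ᴿ (R′ ⨾ᴿ S′) ≈ᴿ (R ⊗ᴿ R′) ⨾ᴿ (S ⊗ᴿ S′)
    ⊗ᴿ-⨾ᴿ {m = m} R S R′ S′ = mk≈ᴿ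
      ( (λ { ((y , r , s) , (y′ , r′ , s′)) → y ++ y′
           , ( resp R ≋-refl (≋-sym (take-++ y y′)) r , resp R′ ≋-refl (≋-sym (drop-++ y y′)) r′ )
           , ( resp S (≋-sym (take-++ y y′)) ≋-refl s , resp S′ (≋-sym (drop-++ y y′)) ≋-refl s′ ) })
      , (λ { (y , (r , r′) , (s , s′)) → (take m y , r , s) , (drop m y , r′ , s′) }) )

  TLinRel-category : Category 0ℓ (lsuc 0ℓ) 0ℓ
  TLinRel-category = record
    { Obj = ℕ
    ; Hom = TotalLinearRelation
    ; _≈_ = _≈ᴿ_
    ; id  = idᴿ
    ; _⨾_ = _⨾ᴿ_
    ; isEquivalence = ≈ᴿ-isEquivalence
    ; ⨾-cong    = ⨾ᴿ-cong
    ; identityˡ = λ R → mk≈ᴿ ( (λ { (y , x≋y , r) → resp R (≋-sym x≋y) ≋-refl r })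
                             , (λ {x} r → x , ≋-refl , r) )
    ; identityʳ = λ R → mk≈ᴿ ( (λ { (y , r , y≋z) → resp R ≋-refl y≋z r })
                             , (λ {_} {z} r → z , r , ≋-refl) )
    ; assoc     = λ R S T → mk≈ᴿ ( (λ { (z , (y , r , s) , t) → y , r , z , s , t })
                                 , (λ { (y , r , z , s , t) → z , (y , r , s) , t }) )
    }

  TLinRel-monoidal : SymmetricMonoidal TLinRel-category
  TLinRel-monoidal = record
    { _⊗₀_   = _+_
    ; unit   = 0
    ; _⊗₁_   = _⊗ᴿ_
    ; ⊗-cong = ⊗ᴿ-cong
    ; ⊗-id   = λ {m} {n} → let A = leaf m; B = leaf n in
               sameᴿ (A ⊗ B) (A ⊗ B) (id⇓ A ⊗⇓ id⇓ B) (id⇓ (A ⊗ B))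
    ; ⊗-⨾    = ⊗ᴿ-⨾ᴿ
    ; associator = λ l m n → let A = leaf l; B = leaf m; C = leaf n in record
      { to = graph (assocₗ l m n)
      ; from = graph (assocₗ⁻¹ l m n)
      ; to⨾from = sameᴿ ((A ⊗ B) ⊗ C) ((A ⊗ B) ⊗ C)
          (graph⇓ (assoc↓ A B C) ⨾⇓ graph⇓ (assoc⁻¹↓ A B C)) (id⇓ _)
      ; from⨾to = sameᴿ (A ⊗ B ⊗ C) (A ⊗ B ⊗ C)
          (graph⇓ (assoc⁻¹↓ A B C) ⨾⇓ graph⇓ (assoc↓ A B C)) (id⇓ _)
      }
    ; unitorˡ = λ n → let A = leaf n in record
      { to = graph (unitˡₗ n)
      ; from = graph (unitˡₗ⁻¹ n)
      ; to⨾from = sameᴿ (∅ ⊗ A) (∅ ⊗ A) (graph⇓ (unitˡ↓ A) ⨾⇓ graph⇓ (unitˡ⁻¹↓ A)) (id⇓ _)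
      ; from⨾to = sameᴿ A A (graph⇓ (unitˡ⁻¹↓ A) ⨾⇓ graph⇓ (unitˡ↓ A)) (id⇓ _)
      }
    ; unitorʳ = λ n → let A = leaf n in record
      { to = graph (unitʳₗ n)
      ; from = graph (unitʳₗ⁻¹ n)
      ; to⨾from = sameᴿ (A ⊗ ∅) (A ⊗ ∅) (graph⇓ (unitʳ↓ A) ⨾⇓ graph⇓ (unitʳ⁻¹↓ A)) (id⇓ _)
      ; from⨾to = sameᴿ A A (graph⇓ (unitʳ⁻¹↓ A) ⨾⇓ graph⇓ (unitʳ↓ A)) (id⇓ _)
      }
    ; braiding = λ m n → graph (swapₗ m n)
    ; associator-natural = assocᴿ-natural
    ; unitorˡ-natural    = unitˡᴿ-natural
    ; unitorʳ-natural    = unitʳᴿ-natural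
    ; braiding-natural   = swapᴿ-natural
    ; triangle = λ m n → let A = leaf m; B = leaf n in
        sameᴿ ((A ⊗ ∅) ⊗ B) (A ⊗ B)
          (graph⇓ (assoc↓ A ∅ B) ⨾⇓ id⇓ A ⊗⇓ graph⇓ (unitˡ↓ B))
          (graph⇓ (unitʳ↓ A) ⊗⇓ id⇓ B)
    ; pentagon = λ k l m n → let A = leaf k; B = leaf l; C = leaf m; D = leaf n in
        sameᴿ (((A ⊗ B) ⊗ C) ⊗ D) (A ⊗ B ⊗ C ⊗ D)
          (graph⇓ (assoc↓ (A ⊗ B) C D) ⨾⇓ graph⇓ (assoc↓ A B (C ⊗ D)))
          (graph⇓ (assoc↓ A B C) ⊗⇓ id⇓ D ⨾⇓ graph⇓ (assoc↓ A (B ⊗ C) D) ⨾⇓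
           id⇓ A ⊗⇓ graph⇓ (assoc↓ B C D))
    ; hexagon = λ l m n → let A = leaf l; B = leaf m; C = leaf n in
        sameᴿ ((A ⊗ B) ⊗ C) (B ⊗ C ⊗ A)
          (graph⇓ (assoc↓ A B C) ⨾⇓ graph⇓ (swap↓ A (B ⊗ C)) ⨾⇓ graph⇓ (assoc↓ B C A))
          (graph⇓ (swap↓ A B) ⊗⇓ id⇓ C ⨾⇓ graph⇓ (assoc↓ B A C) ⨾⇓ id⇓ B ⊗⇓ graph⇓ (swap↓ A C))
    ; braiding-involutive = λ m n → let A = leaf m; B = leaf n in
        sameᴿ (A ⊗ B) (A ⊗ B) (graph⇓ (swap↓ A B) ⨾⇓ graph⇓ (swap↓ B A)) (id⇓ _)
    }

  private
    middleSwap⇓ : ∀ l m n k → let A = leaf l; B = leaf m; C = leaf n; D = leaf k in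
      Computes ((A ⊗ B) ⊗ C ⊗ D) ((A ⊗ C) ⊗ B ⊗ D)
               (SymmetricMonoidal.middleSwap TLinRel-monoidal l m n k)
               (λ ((a , b) , c , d) → (a , c) , b , d)
    middleSwap⇓ l m n k = let A = leaf l; B = leaf m; C = leaf n; D = leaf k in
      graph⇓ (assoc↓ A B (C ⊗ D)) ⨾⇓
      id⇓ A ⊗⇓ (graph⇓ (assoc⁻¹↓ B C D) ⨾⇓ graph⇓ (swap↓ B C) ⊗⇓ id⇓ D ⨾⇓ graph⇓ (assoc↓ C B D)) ⨾⇓
      graph⇓ (assoc⁻¹↓ A C (B ⊗ D))

  TLinRel : MarkovCategory 0ℓ (lsuc 0ℓ) 0ℓ
  TLinRel = record
    { category          = TLinRel-category
    ; symmetricMonoidal = TLinRel-monoidal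
    ; copy = λ n → graph (diagₗ n)
    ; del  = λ n → graph !ₗ
    ; copy-assoc = λ n → let A = leaf n in
        sameᴿ A (A ⊗ A ⊗ A)
          (graph⇓ (diag↓ A) ⨾⇓ graph⇓ (diag↓ A) ⊗⇓ id⇓ A ⨾⇓ graph⇓ (assoc↓ A A A))
          (graph⇓ (diag↓ A) ⨾⇓ id⇓ A ⊗⇓ graph⇓ (diag↓ A))
    ; copy-comm = λ n → let A = leaf n in
        sameᴿ A (A ⊗ A) (graph⇓ (diag↓ A) ⨾⇓ graph⇓ (swap↓ A A)) (graph⇓ (diag↓ A))
    ; copy-delˡ = λ n → let A = leaf n in
        sameᴿ A A (graph⇓ (diag↓ A) ⨾⇓ graph⇓ (!↓ A) ⊗⇓ id⇓ A ⨾⇓ graph⇓ (unitˡ↓ A)) (id⇓ A)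
    ; copy-⊗ = λ m n → let A = leaf m; B = leaf n in
        sameᴿ (A ⊗ B) ((A ⊗ B) ⊗ A ⊗ B) (graph⇓ (diag↓ (A ⊗ B)))
          (graph⇓ (diag↓ A) ⊗⇓ graph⇓ (diag↓ B) ⨾⇓ middleSwap⇓ m m n n)
    ; del-⊗ = λ m n → let A = leaf m; B = leaf n in
        sameᴿ (A ⊗ B) ∅ (graph⇓ (!↓ (A ⊗ B)))
          (graph⇓ (!↓ A) ⊗⇓ graph⇓ (!↓ B) ⨾⇓ graph⇓ (unitˡ↓ ∅))
    ; copy-unit = sameᴿ ∅ ∅ (graph⇓ (diag↓ ∅) ⨾⇓ graph⇓ (unitˡ↓ ∅)) (id⇓ ∅)
    ; del-unit  = sameᴿ ∅ ∅ (graph⇓ (!↓ ∅)) (id⇓ ∅)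
    ; del-natural = λ R → mk≈ᴿ ( (λ _ ()) , (λ {x} _ → let (y , r) = total R x in y , r , λ ()) )
    }

-- Excluded middle is what makes the dimension of a quotient space computable.

module Quotients (ℝ : RealNumbers) (lem : ExcludedMiddle 0ℓ) where

  open RealNumbers ℝ using (Carrier; _≈ʳ_; _+ʳ_; _*ʳ_; -ʳ_; 0ʳ; 1ʳ; invertible; commutativeRing)
  open Linear ℝ
  private
    module R = CommutativeRing commutativeRing
    module RP = RingProperties R.ring
    module R+ = CommutativeSemigroupProperties R.+-commutativeSemigroup

  IsSurjective : ∀ {m n} → m ⊸ n → Set
  IsSurjective f = Surjective _≋_ _≋_ (f $_)

  preimage : ∀ {m n} (f : m ⊸ n) → IsSurjective f → ∀ z → ∃[ y ] f $ y ≋ z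
  preimage f surj z = let (y , fy) = surj z in y , fy ≋-refl

  surjective : ∀ {m n} (f : m ⊸ n) → (∀ z → ∃[ y ] f $ y ≋ z) → IsSurjective f
  surjective f pre z = let (y , fy≋z) = pre z in y , λ w≋y → ≋-trans ($-cong f w≋y) fy≋z

  ⊖-≋𝟎 : ∀ {n} {x y : Vector Carrier n} → x ≋ y → x ⊕ ⊖ y ≋ 𝟎
  ⊖-≋𝟎 x≋y i = RP.x≈y⇒x∙y⁻¹≈ε (x≋y i)

  ≋-⊖𝟎 : ∀ {n} {x y : Vector Carrier n} → x ⊕ ⊖ y ≋ 𝟎 → x ≋ y
  ≋-⊖𝟎 {x = x} {y} p i = RP.x∙y⁻¹≈ε⇒x≈y (x i) (y i) (p i)

  $-⊕⊖ : ∀ {m n} (f : m ⊸ n) x y → f $ (x ⊕ ⊖ y) ≋ (f $ x) ⊕ ⊖ (f $ y)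
  $-⊕⊖ f x y = ≋-trans ($-⊕ f x (⊖ y)) (⊕-cong ≋-refl ($-⊖ f y))

  module Factor {m n k} (p : m ⊸ n) (surj : IsSurjective p) (g : m ⊸ k)
                (ker : ∀ y → p $ y ≋ 𝟎 → g $ y ≋ 𝟎) where

    private
      s : Vector Carrier n → Vector Carrier m
      s z = proj₁ (preimage p surj z)

      ps : ∀ z → p $ s z ≋ z
      ps z = proj₂ (preimage p surj z)

      g-resp : ∀ {y y′} → p $ y ≋ p $ y′ → g $ y ≋ g $ y′
      g-resp {y} {y′} eq = ≋-⊖𝟎 (≋-trans (≋-sym ($-⊕⊖ g y y′))
        (ker (y ⊕ ⊖ y′) (≋-trans ($-⊕⊖ p y y′) (⊖-≋𝟎 eq))))

    factor : n ⊸ k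
    factor $ z = g $ s z
    isLinear factor = linear
      (λ {z} {z′} z≋z′ → g-resp (≋-trans (ps z) (≋-trans z≋z′ (≋-sym (ps z′)))))
      (λ z z′ → ≋-trans
        (g-resp (≋-trans (ps (z ⊕ z′))
          (≋-sym (≋-trans ($-⊕ p (s z) (s z′)) (⊕-cong (ps z) (ps z′))))))
        ($-⊕ g (s z) (s z′)))
      (λ c z → ≋-trans
        (g-resp (≋-trans (ps (c · z)) (≋-sym (≋-trans ($-· p c (s z)) (·-cong c (ps z))))))
        ($-· g c (s z)))

    factor-$ : ∀ y → factor $ (p $ y) ≋ g $ y
    factor-$ y = g-resp (ps (p $ y))

  record Cokernel {m n : ℕ} (f : m ⊸ n) : Set where
    field
      apex        : ℕ
      proj        : n ⊸ apex
      proj-surj   : IsSurjective proj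
      annihilates : ∀ x → proj $ (f $ x) ≋ 𝟎
      exact       : ∀ y → proj $ y ≋ 𝟎 → ∃[ x ] f $ x ≋ y

  private

    line : ∀ {n} → Vector Carrier n → 1 ⊸ n
    line v $ c = c zero · v
    isLinear (line v) = linear
      (λ c≋d i → R.*-congʳ (c≋d zero))
      (λ c d i → R.distribʳ (v i) (c zero) (d zero))
      (λ a c i → R.*-assoc a (c zero) (v i))

    -- With a pivot v i ≠ 0, the quotient of ℝⁿ⁺¹ by v eliminates coordinate i.

    module Pivot {n} (v : Vector Carrier (suc n)) (i : Fin (suc n)) (v≉0 : ¬ (v i ≈ʳ 0ʳ)) where

      u : Carrier
      u = proj₁ (invertible (v i) v≉0)

      coeff : Vector Carrier (suc n) → Carrier
      coeff w = w i *ʳ u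

      coeff-v : ∀ c → (c *ʳ v i) *ʳ u ≈ʳ c
      coeff-v c = R.trans (R.*-assoc c (v i) u)
        (R.trans (R.*-congˡ (proj₂ (invertible (v i) v≉0))) (R.*-identityʳ c))

      v-coeff : ∀ w → coeff w *ʳ v i ≈ʳ w i
      v-coeff w = R.trans (R.*-assoc (w i) u (v i))
        (R.trans (R.*-congˡ (R.trans (R.*-comm u (v i)) (proj₂ (invertible (v i) v≉0))))
                 (R.*-identityʳ (w i)))

      reduce : Vector Carrier (suc n) → Vector Carrier (suc n)
      reduce w = w ⊕ ⊖ (coeff w · v)

      quotient : suc n ⊸ n
      quotient $ w = removeAt (reduce w) i
      isLinear quotient = linear
        (λ w≋w′ j → R.+-cong (w≋w′ _) (R.-‿cong (R.*-congʳ (R.*-congʳ (w≋w′ i)))))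
        (λ w w′ j → let k = punchIn i j in R.trans
          (R.+-congˡ (R.trans (R.-‿cong (R.trans (R.*-congʳ (R.distribʳ u (w i) (w′ i)))
                                                 (R.distribʳ (v k) (coeff w) (coeff w′))))
                              (R.sym (RP.-‿+-comm (coeff w *ʳ v k) (coeff w′ *ʳ v k)))))
          (R+.interchange (w k) (w′ k) _ _))
        (λ c w j → let k = punchIn i j in R.trans
          (R.+-congˡ (R.trans (R.-‿cong (R.trans (R.*-congʳ (R.*-assoc c (w i) u))
                                                 (R.*-assoc c (coeff w) (v k))))
                              (RP.-‿distribʳ-* c (coeff w *ʳ v k))))
          (R.sym (R.distribˡ c (w k) _)))

      cokernel : Cokernel (line v)
      cokernel = record
        { apex = n
        ; proj = quotient
        ; proj-surj = surjective quotient λ z → insertAt z i 0ʳ , λ j → R.trans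
            (R.+-cong (R.reflexive (insertAt-punchIn z i 0ʳ j))
                      (R.trans (R.-‿cong (R.trans (R.*-congʳ (R.trans
                                 (R.*-congʳ (R.reflexive (insertAt-lookup z i 0ʳ)))
                                 (R.zeroˡ u))) (R.zeroˡ _)))
                               RP.-0#≈0#))
            (R.+-identityʳ (z j))
        ; annihilates = λ c j → RP.x≈y⇒x∙y⁻¹≈ε (R.*-congʳ (R.sym (coeff-v (c zero))))
        ; exact = λ w qw≋𝟎 → (λ _ → coeff w) , λ j → exact w qw≋𝟎 j (i ≟ j)
        }
        where
        exact : ∀ w → quotient $ w ≋ 𝟎 → ∀ j → Dec (i ≡ j) → coeff w *ʳ v j ≈ʳ w j
        exact w qw≋𝟎 j (yes ≡.refl) = v-coeff w
        exact w qw≋𝟎 j (no i≢j) = R.sym (RP.x∙y⁻¹≈ε⇒x≈y (w j) (coeff w *ʳ v j)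
          (≡.subst (λ k → w k +ʳ -ʳ (coeff w *ʳ v k) ≈ʳ 0ʳ) (punchIn-punchOut i≢j)
                   (qw≋𝟎 (punchOut i≢j))))

    cokernel-line : ∀ {n} (v : Vector Carrier n) → Cokernel (line v)
    cokernel-line {n} v with lem {∃[ i ] ¬ (v i ≈ʳ 0ʳ)}
    cokernel-line {suc n} v | yes (i , v≉0) = Pivot.cokernel v i v≉0
    cokernel-line {n}     v | no none = record
      { apex = n
      ; proj = idₗ
      ; proj-surj = surjective idₗ λ z → z , ≋-refl
      ; annihilates = λ c i → R.trans (R.*-congˡ (v≈0 i)) (R.zeroʳ (c zero))
      ; exact = λ w w≋𝟎 → 𝟎 , λ i → R.trans (R.zeroˡ (v i)) (R.sym (w≋𝟎 i))
      }
      where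
      v≈0 : ∀ i → v i ≈ʳ 0ʳ
      v≈0 i with lem {v i ≈ʳ 0ʳ}
      ... | yes p = p
      ... | no ¬p with () ← none (i , ¬p)

    shift : ∀ {m} → m ⊸ suc m
    shift $ x = 0ʳ ∷ x
    isLinear shift = linear
      (λ { p zero → R.refl ; p (suc i) → p i })
      (λ { x y zero → R.sym (R.+-identityˡ 0ʳ) ; x y (suc i) → R.refl })
      (λ { c x zero → R.sym (R.zeroʳ c) ; c x (suc i) → R.refl })

    e₀ : ∀ {m} → Vector Carrier (suc m)
    e₀ = 1ʳ ∷ 𝟎

    split : ∀ {m} (x : Vector Carrier (suc m)) → x ≋ (x zero · e₀) ⊕ (shift $ tail x)
    split x zero    = R.sym (R.trans (R.+-identityʳ _) (R.*-identityʳ (x zero)))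
    split x (suc i) = R.sym (R.trans (R.+-congʳ (R.zeroʳ (x zero))) (R.+-identityˡ (x (suc i))))

  cokernel : ∀ {m n} (f : m ⊸ n) → Cokernel f
  cokernel {zero} {n} f = record
    { apex = n
    ; proj = idₗ
    ; proj-surj = surjective idₗ λ z → z , ≋-refl
    ; annihilates = λ x → f-≋𝟎 x
    ; exact = λ y y≋𝟎 → [] , ≋-trans (f-≋𝟎 []) (≋-sym y≋𝟎)
    }
    where
    f-≋𝟎 : ∀ x → f $ x ≋ 𝟎
    f-≋𝟎 x = ≋-trans ($-cong f (λ ())) ($-𝟎 f)
  cokernel {suc m} {n} f = record
    { apex = Q.apex
    ; proj = P.proj ⨾ₗ Q.proj
    ; proj-surj = surjective (P.proj ⨾ₗ Q.proj) λ z →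
        let (y , Qy≋z) = preimage Q.proj Q.proj-surj z
            (x , Px≋y) = preimage P.proj P.proj-surj y
        in x , ≋-trans ($-cong Q.proj Px≋y) Qy≋z
    ; annihilates = λ x →
        ≋-trans ($-cong Q.proj (P-f x)) (Q.annihilates (λ _ → x zero))
    ; exact = λ y QPy≋𝟎 →
        let (c , cv≋Py) = Q.exact (P.proj $ y) QPy≋𝟎
            c₀ = c zero
            (x , fx≋) = P.exact (y ⊕ ⊖ (c₀ · v)) (≋-trans ($-⊕⊖ P.proj y (c₀ · v))
                          (⊖-≋𝟎 (≋-trans (≋-sym cv≋Py) (≋-sym ($-· P.proj c₀ v)))))
        in (c₀ · e₀) ⊕ (shift $ x) ,
           ≋-trans ($-⊕ f (c₀ · e₀) (shift $ x))
           (≋-trans (⊕-cong ($-· f c₀ e₀) fx≋) (cancel (c₀ · v) y))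
    }
    where
    v = f $ e₀
    module P = Cokernel (cokernel (shift ⨾ₗ f))
    module Q = Cokernel (cokernel-line (P.proj $ v))

    P-f : ∀ x → P.proj $ (f $ x) ≋ x zero · (P.proj $ v)
    P-f x = ≋-trans ($-cong P.proj (≋-trans ($-cong f (split x)) ($-⊕ f (x zero · e₀) _)))
      (≋-trans ($-⊕ P.proj (f $ (x zero · e₀)) (f $ (shift $ tail x)))
      (≋-trans (⊕-cong (≋-trans ($-cong P.proj ($-· f (x zero) e₀)) ($-· P.proj (x zero) v))
                       (P.annihilates (tail x)))
               (λ i → R.+-identityʳ _)))

    cancel : ∀ {k} (a b : Vector Carrier k) → a ⊕ (b ⊕ ⊖ a) ≋ b
    cancel a b i = R.trans (R.+-congˡ (R.+-comm (b i) (-ʳ a i)))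
      (R.trans (R.sym (R.+-assoc (a i) (-ʳ a i) (b i)))
      (R.trans (R.+-congʳ (R.-‿inverseʳ (a i))) (R.+-identityˡ (b i))))

  -- The pushout of f and g is the cokernel of ⟨ f , - g ⟩.

  module Pushout {m n k : ℕ} (f : m ⊸ n) (g : m ⊸ k) where

    negₗ : m ⊸ k
    negₗ $ x = ⊖ (g $ x)
    isLinear negₗ = linear
      (λ x≋y i → R.-‿cong ($-cong g x≋y i))
      (λ x y i → R.trans (R.-‿cong ($-⊕ g x y i)) (R.sym (RP.-‿+-comm _ _)))
      (λ c x i → R.trans (R.-‿cong ($-· g c x i)) (RP.-‿distribʳ-* c _))

    private
      module Q = Cokernel (cokernel ⟨ f , negₗ ⟩)

    apex : ℕ
    apex = Q.apex

    i₁ : n ⊸ apex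
    i₁ = ⟨ idₗ , zeroₗ ⟩ ⨾ₗ Q.proj

    i₂ : k ⊸ apex
    i₂ = ⟨ zeroₗ , idₗ ⟩ ⨾ₗ Q.proj

    private
      proj-split : ∀ x → Q.proj $ x ≋ (i₁ $ take n x) ⊕ (i₂ $ drop n x)
      proj-split x = ≋-trans ($-cong Q.proj (take-drop n
          (λ i → R.sym (R.trans (R.+-cong (take-++ (take n x) 𝟎 i) (take-++ 𝟎 (drop n x) i))
                                (R.+-identityʳ _)))
          (λ i → R.sym (R.trans (R.+-cong (drop-++ (take n x) 𝟎 i) (drop-++ {n} 𝟎 (drop n x) i))
                                (R.+-identityˡ _)))))
        ($-⊕ Q.proj (take n x ++ 𝟎) (𝟎 ++ drop n x))

      proj-++ : ∀ x y → Q.proj $ (x ++ ⊖ y) ≋ (i₁ $ x) ⊕ ⊖ (i₂ $ y)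
      proj-++ x y = ≋-trans (proj-split (x ++ ⊖ y))
        (⊕-cong ($-cong i₁ (take-++ x (⊖ y)))
                (≋-trans ($-cong i₂ (drop-++ x (⊖ y))) ($-⊖ i₂ y)))

    commutes : f ⨾ₗ i₁ ≗ g ⨾ₗ i₂
    commutes x = ≋-⊖𝟎 (≋-trans (≋-sym (proj-++ (f $ x) (g $ x))) (Q.annihilates x))

    equalised : ∀ {x y} → i₁ $ x ≋ i₂ $ y → ∃[ w ] (f $ w ≋ x) × (g $ w ≋ y)
    equalised {x} {y} eq =
      let (w , fw≋) = Q.exact (x ++ ⊖ y) (≋-trans (proj-++ x y) (⊖-≋𝟎 eq))
      in w
       , ≋-trans (≋-sym (take-++ (f $ w) (⊖ (g $ w))))
                 (≋-trans ($-cong (fst n k) fw≋) (take-++ x (⊖ y)))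
       , λ i → RP.-‿injective (≋-trans (≋-sym (drop-++ (f $ w) (⊖ (g $ w))))
                 (≋-trans ($-cong (snd n k) fw≋) (drop-++ x (⊖ y))) i)

    i₂-surjective : IsSurjective f → IsSurjective i₂
    i₂-surjective surj = surjective i₂ λ z →
      let (x , Qx≋z) = preimage Q.proj Q.proj-surj z
          (w , fw≋)  = preimage f surj (take n x)
      in (g $ w) ⊕ drop n x ,
         ≋-trans ($-⊕ i₂ (g $ w) (drop n x))
         (≋-trans (⊕-cong (≋-trans (≋-sym (commutes w)) ($-cong i₁ fw≋)) ≋-refl)
         (≋-trans (≋-sym (proj-split x)) Qx≋z))

    private
      copair : ∀ {l} → n ⊸ l → k ⊸ l → (n + k) ⊸ l
      copair k₁ k₂ $ x = (k₁ $ take n x) ⊕ (k₂ $ drop n x)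
      isLinear (copair k₁ k₂) = linear
        (λ x≋y → ⊕-cong ($-cong k₁ ($-cong (fst n k) x≋y)) ($-cong k₂ ($-cong (snd n k) x≋y)))
        (λ x y i → R.trans (R.+-cong ($-⊕ k₁ (take n x) (take n y) i) ($-⊕ k₂ (drop n x) (drop n y) i))
                           (R+.interchange _ _ _ _))
        (λ c x i → R.trans (R.+-cong ($-· k₁ c (take n x) i) ($-· k₂ c (drop n x) i))
                           (R.sym (R.distribˡ c _ _)))

      module Universal {l} (k₁ : n ⊸ l) (k₂ : k ⊸ l) (eq : f ⨾ₗ k₁ ≗ g ⨾ₗ k₂) where

        vanishes : ∀ y → Q.proj $ y ≋ 𝟎 → copair k₁ k₂ $ y ≋ 𝟎
        vanishes y Qy≋𝟎 =
          let (w , fw≋y) = Q.exact y Qy≋𝟎 in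
          ≋-trans ($-cong (copair k₁ k₂) (≋-sym fw≋y))
          (≋-trans (⊕-cong ($-cong k₁ (take-++ (f $ w) _))
                           (≋-trans ($-cong k₂ (drop-++ (f $ w) _)) ($-⊖ k₂ (g $ w))))
                   (⊖-≋𝟎 (eq w)))

        open Factor Q.proj Q.proj-surj (copair k₁ k₂) vanishes public

        i₁⨾factor : i₁ ⨾ₗ factor ≗ k₁
        i₁⨾factor x = ≋-trans (factor-$ (x ++ 𝟎)) (≋-trans
          (⊕-cong ($-cong k₁ (take-++ x 𝟎)) (≋-trans ($-cong k₂ (drop-++ x 𝟎)) ($-𝟎 k₂)))
          (λ i → R.+-identityʳ _))

        i₂⨾factor : i₂ ⨾ₗ factor ≗ k₂
        i₂⨾factor y = ≋-trans (factor-$ (𝟎 ++ y)) (≋-trans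
          (⊕-cong (≋-trans ($-cong k₁ (take-++ 𝟎 y)) ($-𝟎 k₁)) ($-cong k₂ (drop-++ {n} 𝟎 y)))
          (λ i → R.+-identityˡ _))

    isPushout : Category.IsPushout Vec f g i₁ i₂
    isPushout = record
      { commutes     = commutes
      ; universal    = Universal.factor
      ; i₁⨾universal = Universal.i₁⨾factor
      ; i₂⨾universal = Universal.i₂⨾factor
      ; unique = λ u v eq₁ eq₂ z →
          let (x , Qx≋z) = preimage Q.proj Q.proj-surj z
              split = λ (w : apex ⊸ _) → ≋-trans ($-cong w (≋-trans (≋-sym Qx≋z) (proj-split x)))
                                                  ($-⊕ w (i₁ $ take n x) (i₂ $ drop n x))
          in ≋-trans (split u) (≋-trans (⊕-cong (eq₁ (take n x)) (eq₂ (drop n x)))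
                                        (≋-sym (split v)))
      }

module CopartialMaps (ℝ : RealNumbers) (lem : ExcludedMiddle 0ℓ) where

  open RealNumbers ℝ using (Carrier)
  open Linear ℝ
  open LinearRelations ℝ
  open Quotients ℝ lem
  open Category Vec using () renaming (_≅_ to _≅ₗ_; to to toₗ; from to fromₗ; to⨾from to to⨾fromₗ)

  record Copartial (m n : ℕ) : Set where
    no-eta-equality
    field
      apex       : ℕ
      left       : m ⊸ apex
      right      : n ⊸ apex
      right-surj : IsSurjective right

  open Copartial public

  infix 4 _≈ᶜ_
  record _≈ᶜ_ {m n} (c d : Copartial m n) : Set where
    constructor mk≈ᶜ
    field
      apex-≅  : apex c ≅ₗ apex d
      left-≗  : left c ⨾ₗ toₗ apex-≅ ≗ left d
      right-≗ : right c ⨾ₗ toₗ apex-≅ ≗ right d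

  open _≈ᶜ_ public

  cospan : ∀ {m n} → m ⊸ n → Copartial m n
  apex  (cospan {n = n} f) = n
  left  (cospan f) = f
  right (cospan f) = idₗ
  right-surj (cospan f) = surjective idₗ λ z → z , ≋-refl

  idᶜ : ∀ {n} → Copartial n n
  idᶜ = cospan idₗ

  infixl 9 _⨾ᶜ_
  _⨾ᶜ_ : ∀ {l m n} → Copartial l m → Copartial m n → Copartial l n
  apex  (c ⨾ᶜ d) = Pushout.apex (right c) (left d)
  left  (c ⨾ᶜ d) = left c ⨾ₗ Pushout.i₁ (right c) (left d)
  right (c ⨾ᶜ d) = right d ⨾ₗ Pushout.i₂ (right c) (left d)
  right-surj (c ⨾ᶜ d) = surjective (right (c ⨾ᶜ d)) λ z →
    let (y , iy≋z) = preimage (Pushout.i₂ (right c) (left d))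
                              (Pushout.i₂-surjective (right c) (left d) (right-surj c)) z
        (x , qx≋y) = preimage (right d) (right-surj d) y
    in x , ≋-trans ($-cong (Pushout.i₂ (right c) (left d)) qx≋y) iy≋z

  infixr 10 _⊗ᶜ_
  _⊗ᶜ_ : ∀ {m n m′ n′} → Copartial m m′ → Copartial n n′ → Copartial (m + n) (m′ + n′)
  apex  (c ⊗ᶜ d) = apex c + apex d
  left  (c ⊗ᶜ d) = left c ⊗ₗ left d
  right (c ⊗ᶜ d) = right c ⊗ₗ right d
  right-surj (c ⊗ᶜ d) = surjective (right c ⊗ₗ right d) λ z →
    let (x , px≋) = preimage (right c) (right-surj c) (take (apex c) z)
        (y , qy≋) = preimage (right d) (right-surj d) (drop (apex c) z)
    in x ++ y , take-drop (apex c)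
         (≋-trans (take-++ (right c $ take _ (x ++ y)) _)
                  (≋-trans ($-cong (right c) (take-++ x y)) px≋))
         (≋-trans (drop-++ (right c $ take _ (x ++ y)) _)
                  (≋-trans ($-cong (right d) (drop-++ x y)) qy≋))

  -- Two cospans are isomorphic as soon as they relate the same vectors
  -- (left c $ x ≋ right c $ y), so the laws below follow from those of relations.

  relation : ∀ {m n} → Copartial m n → TotalLinearRelation m n
  rel   (relation c) x y = left c $ x ≋ right c $ y
  resp  (relation c) p q r = ≋-trans ($-cong (left c) (≋-sym p)) (≋-trans r ($-cong (right c) q))
  rel-𝟎 (relation c) = ≋-trans ($-𝟎 (left c)) (≋-sym ($-𝟎 (right c)))
  rel-⊕ (relation c) {x} {x′} {y} {y′} r r′ =
    ≋-trans ($-⊕ (left c) x x′) (≋-trans (⊕-cong r r′) (≋-sym ($-⊕ (right c) y y′)))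
  rel-· (relation c) a {x} {y} r =
    ≋-trans ($-· (left c) a x) (≋-trans (·-cong a r) (≋-sym ($-· (right c) a y)))
  total (relation c) x =
    let (y , py≋) = preimage (right c) (right-surj c) (left c $ x) in y , ≋-sym py≋

  infix 4 _↦_
  record _↦_ {m n} (c : Copartial m n) (R : TotalLinearRelation m n) : Set where
    constructor represents
    field
      sound    : ∀ {x y} → left c $ x ≋ right c $ y → rel R x y
      complete : ∀ {x y} → rel R x y → left c $ x ≋ right c $ y
  open _↦_ public

  self : ∀ {m n} (c : Copartial m n) → c ↦ relation c
  self c = represents (λ r → r) (λ r → r)

  cospan↦ : ∀ {m n} (f : m ⊸ n) → cospan f ↦ graph f
  cospan↦ f = represents (λ r → r) (λ r → r)

  infixl 9 _⨾↦_
  _⨾↦_ : ∀ {l m n} {c : Copartial l m} {d : Copartial m n} {R S} →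
         c ↦ R → d ↦ S → c ⨾ᶜ d ↦ R ⨾ᴿ S
  _⨾↦_ {c = c} {d} p q = represents
    (λ r → let (y , py≋ , gy≋) = P.equalised r in
           y , sound p (≋-sym py≋) , sound q gy≋)
    (λ { (y , r , s) → ≋-trans ($-cong P.i₁ (complete p r))
                       (≋-trans (P.commutes y) ($-cong P.i₂ (complete q s))) })
    where module P = Pushout (right c) (left d)

  infixr 10 _⊗↦_
  _⊗↦_ : ∀ {m n m′ n′} {c : Copartial m m′} {d : Copartial n n′} {R S} →
         c ↦ R → d ↦ S → c ⊗ᶜ d ↦ R ⊗ᴿ S
  _⊗↦_ {m} {n} {m′} {n′} {c} {d} p q = represents
    (λ {x} {y} r →
        sound p (≋-trans (≋-sym (take-++ (left c $ take m x) _))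
                (≋-trans ($-cong (fst (apex c) (apex d)) r) (take-++ (right c $ take m′ y) _)))
      , sound q (≋-trans (≋-sym (drop-++ (left c $ take m x) _))
                (≋-trans ($-cong (snd (apex c) (apex d)) r) (drop-++ (right c $ take m′ y) _))))
    (λ { (r , s) → ++-cong (complete p r) (complete q s) })

  ≈ᶜ⇒≈ᴿ : ∀ {m n} {c d : Copartial m n} → c ≈ᶜ d → relation c ≈ᴿ relation d
  ≈ᶜ⇒≈ᴿ {c = c} {d} (mk≈ᶜ φ l r) = mk≈ᴿ
    ( (λ {x} {y} e → ≋-trans (≋-sym (l x)) (≋-trans ($-cong (toₗ φ) e) (r y)))
    , (λ {x} {y} e → ≋-trans (≋-sym (to⨾fromₗ φ (left c $ x)))
                     (≋-trans ($-cong (fromₗ φ) (≋-trans (l x) (≋-trans e (≋-sym (r y)))))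
                              (to⨾fromₗ φ (right c $ y)))) )

  module Comparison {m n} (c d : Copartial m n)
                    (c⊆d : ∀ {x y} → rel (relation c) x y → rel (relation d) x y) where

    vanishes : ∀ y → right c $ y ≋ 𝟎 → right d $ y ≋ 𝟎
    vanishes y cy≋𝟎 =
      ≋-trans (≋-sym (c⊆d (≋-trans ($-𝟎 (left c)) (≋-sym cy≋𝟎)))) ($-𝟎 (left d))

    open Factor (right c) (right-surj c) (right d) vanishes public

    factor-left : left c ⨾ₗ factor ≗ left d
    factor-left x =
      let (y , r) = total (relation c) x in
      ≋-trans ($-cong factor r) (≋-trans (factor-$ y) (≋-sym (c⊆d r)))

  inverse : ∀ {m n} (c d : Copartial m n)
            (c⊆d : ∀ {x y} → rel (relation c) x y → rel (relation d) x y)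
            (d⊆c : ∀ {x y} → rel (relation d) x y → rel (relation c) x y) →
            Comparison.factor c d c⊆d ⨾ₗ Comparison.factor d c d⊆c ≗ idₗ
  inverse c d c⊆d d⊆c z =
    let (y , cy≋z) = preimage (right c) (right-surj c) z in
    ≋-trans ($-cong D.factor (≋-trans ($-cong C.factor (≋-sym cy≋z)) (C.factor-$ y)))
            (≋-trans (D.factor-$ y) cy≋z)
    where
    module C = Comparison c d c⊆d
    module D = Comparison d c d⊆c

  ≈ᴿ⇒≈ᶜ : ∀ {m n} {c d : Copartial m n} → relation c ≈ᴿ relation d → c ≈ᶜ d
  ≈ᴿ⇒≈ᶜ {c = c} {d} (mk≈ᴿ (c⊆d , d⊆c)) = record
    { apex-≅ = record
      { to       = Comparison.factor c d c⊆d
      ; from     = Comparison.factor d c d⊆c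
      ; to⨾from  = inverse c d c⊆d d⊆c
      ; from⨾to  = inverse d c d⊆c c⊆d
      }
    ; left-≗  = Comparison.factor-left c d c⊆d
    ; right-≗ = Comparison.factor-$ c d c⊆d
    }

  reflect : ∀ {m n} {c d : Copartial m n} {R S} → c ↦ R → d ↦ S → R ≈ᴿ S → c ≈ᶜ d
  reflect p q (mk≈ᴿ (R⊆S , S⊆R)) = ≈ᴿ⇒≈ᶜ (mk≈ᴿ
    ((λ r → complete q (R⊆S (sound p r))) , (λ s → complete p (S⊆R (sound q s)))))

  id↦ : ∀ {n} → idᶜ {n} ↦ idᴿ
  id↦ = cospan↦ idₗ

  private
    module T = MarkovCategory TLinRel

  Copar-category : Category 0ℓ 0ℓ 0ℓ
  Copar-category = record
    { Obj = ℕ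
    ; Hom = Copartial
    ; _≈_ = _≈ᶜ_
    ; id  = idᶜ
    ; _⨾_ = _⨾ᶜ_
    ; isEquivalence = record
      { refl  = ≈ᴿ⇒≈ᶜ T.≈-refl
      ; sym   = λ p → ≈ᴿ⇒≈ᶜ (T.≈-sym (≈ᶜ⇒≈ᴿ p))
      ; trans = λ p q → ≈ᴿ⇒≈ᶜ (T.≈-trans (≈ᶜ⇒≈ᴿ p) (≈ᶜ⇒≈ᴿ q))
      }
    ; ⨾-cong = λ {_} {_} {_} {c} {c′} {d} {d′} p q →
        reflect (self c ⨾↦ self d) (self c′ ⨾↦ self d′) (T.⨾-cong (≈ᶜ⇒≈ᴿ p) (≈ᶜ⇒≈ᴿ q))
    ; identityˡ = λ c → reflect (id↦ ⨾↦ self c) (self c) (T.identityˡ (relation c))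
    ; identityʳ = λ c → reflect (self c ⨾↦ id↦) (self c) (T.identityʳ (relation c))
    ; assoc = λ c d e → reflect (self c ⨾↦ self d ⨾↦ self e) (self c ⨾↦ (self d ⨾↦ self e))
                                (T.assoc (relation c) (relation d) (relation e))
    }

  Copar-monoidal : SymmetricMonoidal Copar-category
  Copar-monoidal = record
    { _⊗₀_   = _+_
    ; unit   = 0
    ; _⊗₁_   = _⊗ᶜ_
    ; ⊗-cong = λ {_} {_} {_} {_} {c} {c′} {d} {d′} p q →
        reflect (self c ⊗↦ self d) (self c′ ⊗↦ self d′) (T.⊗-cong (≈ᶜ⇒≈ᴿ p) (≈ᶜ⇒≈ᴿ q))
    ; ⊗-id = reflect (id↦ ⊗↦ id↦) id↦ T.⊗-id
    ; ⊗-⨾ = λ c d c′ d′ → reflect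
        ((self c ⨾↦ self d) ⊗↦ (self c′ ⨾↦ self d′)) (self c ⊗↦ self c′ ⨾↦ self d ⊗↦ self d′)
        (T.⊗-⨾ (relation c) (relation d) (relation c′) (relation d′))
    ; associator = λ l m n → record
      { to = cospan (assocₗ l m n)
      ; from = cospan (assocₗ⁻¹ l m n)
      ; to⨾from = reflect (α↦ l m n ⨾↦ cospan↦ _) id↦ (T.to⨾from (T.associator l m n))
      ; from⨾to = reflect (cospan↦ _ ⨾↦ α↦ l m n) id↦ (T.from⨾to (T.associator l m n))
      }
    ; unitorˡ = λ n → record
      { to = cospan (unitˡₗ n)
      ; from = cospan (unitˡₗ⁻¹ n)
      ; to⨾from = reflect (λ↦ n ⨾↦ cospan↦ _) id↦ (T.to⨾from (T.unitorˡ n))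
      ; from⨾to = reflect (cospan↦ _ ⨾↦ λ↦ n) id↦ (T.from⨾to (T.unitorˡ n))
      }
    ; unitorʳ = λ n → record
      { to = cospan (unitʳₗ n)
      ; from = cospan (unitʳₗ⁻¹ n)
      ; to⨾from = reflect (ρ↦ n ⨾↦ cospan↦ _) id↦ (T.to⨾from (T.unitorʳ n))
      ; from⨾to = reflect (cospan↦ _ ⨾↦ ρ↦ n) id↦ (T.from⨾to (T.unitorʳ n))
      }
    ; braiding = λ m n → cospan (swapₗ m n)
    ; associator-natural = λ {l} {m} {n} {l′} {m′} {n′} c d e → reflect
        ((self c ⊗↦ self d) ⊗↦ self e ⨾↦ α↦ l′ m′ n′) (α↦ l m n ⨾↦ self c ⊗↦ self d ⊗↦ self e)
        (T.associator-natural (relation c) (relation d) (relation e))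
    ; unitorˡ-natural = λ {n} {n′} c → reflect
        (id↦ ⊗↦ self c ⨾↦ λ↦ n′) (λ↦ n ⨾↦ self c) (T.unitorˡ-natural (relation c))
    ; unitorʳ-natural = λ {n} {n′} c → reflect
        (self c ⊗↦ id↦ ⨾↦ ρ↦ n′) (ρ↦ n ⨾↦ self c) (T.unitorʳ-natural (relation c))
    ; braiding-natural = λ {m} {n} {m′} {n′} c d → reflect
        (self c ⊗↦ self d ⨾↦ σ↦ m′ n′) (σ↦ m n ⨾↦ self d ⊗↦ self c)
        (T.braiding-natural (relation c) (relation d))
    ; triangle = λ m n → reflect (α↦ m 0 n ⨾↦ id↦ ⊗↦ λ↦ n) (ρ↦ m ⊗↦ id↦) (T.triangle m n)
    ; pentagon = λ k l m n → reflect
        (α↦ (k + l) m n ⨾↦ α↦ k l (m + n))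
        (α↦ k l m ⊗↦ id↦ ⨾↦ α↦ k (l + m) n ⨾↦ id↦ ⊗↦ α↦ l m n)
        (T.pentagon k l m n)
    ; hexagon = λ l m n → reflect
        (α↦ l m n ⨾↦ σ↦ l (m + n) ⨾↦ α↦ m n l)
        (σ↦ l m ⊗↦ id↦ ⨾↦ α↦ m l n ⨾↦ id↦ ⊗↦ σ↦ l n)
        (T.hexagon l m n)
    ; braiding-involutive = λ m n → reflect (σ↦ m n ⨾↦ σ↦ n m) id↦ (T.braiding-involutive m n)
    }
    where
    α↦ : ∀ l m n → cospan (assocₗ l m n) ↦ graph (assocₗ l m n)
    α↦ l m n = cospan↦ (assocₗ l m n)
    λ↦ : ∀ n → cospan (unitˡₗ n) ↦ graph (unitˡₗ n)
    λ↦ n = cospan↦ (unitˡₗ n)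
    ρ↦ : ∀ n → cospan (unitʳₗ n) ↦ graph (unitʳₗ n)
    ρ↦ n = cospan↦ (unitʳₗ n)
    σ↦ : ∀ m n → cospan (swapₗ m n) ↦ graph (swapₗ m n)
    σ↦ m n = cospan↦ (swapₗ m n)

  Copar-Vec : MarkovCategory 0ℓ 0ℓ 0ℓ
  Copar-Vec = record
    { category          = Copar-category
    ; symmetricMonoidal = Copar-monoidal
    ; copy = λ n → cospan (diagₗ n)
    ; del  = λ n → cospan !ₗ
    ; copy-assoc = λ n → reflect
        (cospan↦ _ ⨾↦ cospan↦ _ ⊗↦ id↦ ⨾↦ cospan↦ _) (cospan↦ _ ⨾↦ id↦ ⊗↦ cospan↦ _)
        (T.copy-assoc n)
    ; copy-comm = λ n → reflect (cospan↦ _ ⨾↦ cospan↦ _) (cospan↦ _) (T.copy-comm n)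
    ; copy-delˡ = λ n → reflect
        (cospan↦ _ ⨾↦ cospan↦ _ ⊗↦ id↦ ⨾↦ cospan↦ _) id↦ (T.copy-delˡ n)
    ; copy-⊗ = λ m n → reflect
        (cospan↦ _)
        (cospan↦ _ ⊗↦ cospan↦ _ ⨾↦
          (cospan↦ _ ⨾↦ id↦ ⊗↦ (cospan↦ _ ⨾↦ cospan↦ _ ⊗↦ id↦ ⨾↦ cospan↦ _) ⨾↦ cospan↦ _))
        (T.copy-⊗ m n)
    ; del-⊗ = λ m n → reflect
        (cospan↦ _) (cospan↦ _ ⊗↦ cospan↦ _ ⨾↦ cospan↦ _) (T.del-⊗ m n)
    ; copy-unit = reflect (cospan↦ _ ⨾↦ cospan↦ _) id↦ T.copy-unit
    ; del-unit = reflect (cospan↦ _) id↦ T.del-unit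
    ; del-natural = λ c → reflect (self c ⨾↦ cospan↦ _) (cospan↦ _) (T.del-natural (relation c))
    }

{-# OPTIONS --safe #-}

-- A cospan (f , p) with p surjective is determined up to isomorphism by the total
-- relation f x = p y, and this passage from cospans to relations respects all the
-- structure.  It remains to see that every total linear relation R : ℝᵐ → ℝⁿ arises:
-- take p : ℝⁿ → ℝⁿ/K with K = { y | R 0 y } and f x = p y for any y with R x y.

module Submission where

open import Algebra.Bundles using (CommutativeRing)
import Algebra.Properties.CommutativeSemigroup as CommutativeSemigroupProperties
import Algebra.Properties.Ring as RingProperties
open import Axiom.ExcludedMiddle using (ExcludedMiddle)
open import Data.Fin.Base using (zero; suc)
open import Data.Nat.Base using (ℕ; zero; suc)
open import Data.Product.Base using (∃-syntax; _×_; _,_)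
open import Data.Vec.Functional using (Vector; _∷_; tail)
open import Level using (0ℓ)
open import Relation.Nullary using (¬_; yes; no)
open import Relation.Nullary.Decidable using (decidable-stable)
open import Relation.Unary using (Pred)
open import Defs

-- Quotients of ℝⁿ by arbitrary subspaces.

module Subspaces (ℝ : RealNumbers) (lem : ExcludedMiddle 0ℓ) where

  open RealNumbers ℝ using (Carrier; _≈ʳ_; _+ʳ_; _*ʳ_; -ʳ_; 0ʳ; 1ʳ; invertible; commutativeRing)
  open Linear ℝ
  open Quotients ℝ lem
  private
    module R = CommutativeRing commutativeRing
    module RP = RingProperties R.ring
    module R+ = CommutativeSemigroupProperties R.+-commutativeSemigroup

  record Subspace (n : ℕ) : Set₁ where
    field
      member : Pred (Vector Carrier n) 0ℓ
      resp   : ∀ {x y} → x ≋ y → member x → member y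
      has-𝟎  : member 𝟎
      has-⊕  : ∀ {x y} → member x → member y → member (x ⊕ y)
      has-·  : ∀ c {x} → member x → member (c · x)

  open Subspace public

  hyperplane-section : ∀ {n} → Subspace (suc n) → Subspace n
  hyperplane-section K = record
    { member = λ z → member K (0ʳ ∷ z)
    ; resp   = λ x≋y → resp K λ { zero → R.refl ; (suc i) → x≋y i }
    ; has-𝟎  = resp K (λ { zero → R.refl ; (suc i) → R.refl }) (has-𝟎 K)
    ; has-⊕  = λ p q → resp K (λ { zero → R.+-identityˡ 0ʳ ; (suc i) → R.refl }) (has-⊕ K p q)
    ; has-·  = λ c p → resp K (λ { zero → R.zeroʳ c ; (suc i) → R.refl }) (has-· K c p)
    }

  -- This is the data of a `Cokernel`, except that the kernel is prescribed by a predicate instead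
  -- of as the image of a map; no spanning family of `K` has to be chosen.
  record Quotient {n} (K : Subspace n) : Set where
    field
      apex      : ℕ
      proj      : n ⊸ apex
      proj-surj : IsSurjective proj
      kills     : ∀ {y} → member K y → proj $ y ≋ 𝟎
      exact     : ∀ {y} → proj $ y ≋ 𝟎 → member K y

    identifies : ∀ {y y′} → member K (y ⊕ ⊖ y′) → proj $ y ≋ proj $ y′
    identifies {y} {y′} k = ≋-⊖𝟎 (≋-trans (≋-sym ($-⊕⊖ proj y y′)) (kills k))

    separates : ∀ {y y′} → proj $ y ≋ proj $ y′ → member K (y ⊕ ⊖ y′)
    separates {y} {y′} eq = exact (≋-trans ($-⊕⊖ proj y y′) (⊖-≋𝟎 eq))

  -- If K contains b with first coordinate -1, every vector is congruent modulo K to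
  -- one with first coordinate 0, and the quotient is that of the section of K.

  module Eliminate {n} (K : Subspace (suc n)) (b : Vector Carrier (suc n))
                   (b∈K : member K b) (b₀≈-1 : b zero ≈ʳ -ʳ 1ʳ)
                   (Q : Quotient (hyperplane-section K)) where

    private module Q = Quotient Q

    reduce : Vector Carrier (suc n) → Vector Carrier (suc n)
    reduce w = w ⊕ w zero · b

    reduce-zero : ∀ w → reduce w zero ≈ʳ 0ʳ
    reduce-zero w = R.trans
      (R.+-congˡ (R.trans (R.*-congˡ b₀≈-1)
        (R.trans (R.sym (RP.-‿distribʳ-* (w zero) 1ʳ)) (R.-‿cong (R.*-identityʳ (w zero))))))
      (R.-‿inverseʳ (w zero))

    reduce-shape : ∀ w → reduce w ≋ 0ʳ ∷ tail (reduce w)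
    reduce-shape w zero    = reduce-zero w
    reduce-shape w (suc i) = R.refl

    unreduce : ∀ w → reduce w ⊕ (-ʳ w zero) · b ≋ w
    unreduce w i = R.trans (R.+-assoc (w i) _ _) (R.trans
      (R.+-congˡ (R.trans (R.sym (R.distribʳ (b i) (w zero) (-ʳ w zero)))
                 (R.trans (R.*-congʳ (R.-‿inverseʳ (w zero))) (R.zeroˡ (b i)))))
      (R.+-identityʳ (w i)))

    eliminate : suc n ⊸ n
    eliminate $ w = tail (reduce w)
    isLinear eliminate = linear
      (λ w≋w′ i → R.+-cong (w≋w′ (suc i)) (R.*-congʳ (w≋w′ zero)))
      (λ w w′ i → R.trans (R.+-congˡ (R.distribʳ (b (suc i)) (w zero) (w′ zero)))
                          (R+.interchange _ _ _ _))
      (λ c w i → R.trans (R.+-congˡ (R.*-assoc c (w zero) (b (suc i))))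
                         (R.sym (R.distribˡ c _ _)))

    quotient : Quotient K
    quotient = record
      { apex      = Q.apex
      ; proj      = eliminate ⨾ₗ Q.proj
      ; proj-surj = surjective (eliminate ⨾ₗ Q.proj) λ z →
          let (y , Qy≋z) = preimage Q.proj Q.proj-surj z in
          -- A vector with first coordinate 0 receives the multiple zero of `b`, so `eliminate`
          -- returns its tail.
          0ʳ ∷ y , ≋-trans ($-cong Q.proj λ i → R.trans (R.+-congˡ (R.zeroˡ _)) (R.+-identityʳ (y i)))
                           Qy≋z
      -- `reduce w` and `w` differ by a multiple of `b`, so one lies in `K` exactly when the other
      -- does.
      ; kills     = λ {w} w∈K → Q.kills (resp K (reduce-shape w) (has-⊕ K w∈K (has-· K (w zero) b∈K)))
      ; exact     = λ {w} Qw≋𝟎 → resp K (unreduce w)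
          (has-⊕ K (resp K (≋-sym (reduce-shape w)) (Q.exact Qw≋𝟎)) (has-· K (-ʳ w zero) b∈K))
      }

  -- Here `K` amounts to the zero space times its section, so the first coordinate survives in the
  -- quotient and the apex grows by one.
  module Keep {n} (K : Subspace (suc n)) (K₀≈0 : ∀ {w} → member K w → w zero ≈ʳ 0ʳ)
              (Q : Quotient (hyperplane-section K)) where

    private module Q = Quotient Q

    shape : ∀ {w : Vector Carrier (suc n)} → w zero ≈ʳ 0ʳ → w ≋ 0ʳ ∷ tail w
    shape w₀≈0 zero    = w₀≈0
    shape w₀≈0 (suc i) = R.refl

    quotient : Quotient K
    quotient = record
      { apex      = suc Q.apex
      ; proj      = idₗ {1} ⊗ₗ Q.proj
      ; proj-surj = surjective (idₗ {1} ⊗ₗ Q.proj) λ z →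
          let (y , Qy≋z) = preimage Q.proj Q.proj-surj (tail z) in
          z zero ∷ y , λ { zero → R.refl ; (suc i) → Qy≋z i }
      ; kills     = λ w∈K → λ
          { zero    → K₀≈0 w∈K
          ; (suc i) → Q.kills (resp K (shape (K₀≈0 w∈K)) w∈K) i }
      ; exact     = λ w≋𝟎 → resp K (≋-sym (shape (w≋𝟎 zero))) (Q.exact (λ i → w≋𝟎 (suc i)))
      }

  -- Induction on the dimension. Excluded middle decides whether `K` leaves the hyperplane of
  -- vectors with first coordinate 0.
  quotient : ∀ {n} (K : Subspace n) → Quotient K
  quotient {zero} K = record
    { apex      = 0
    ; proj      = idₗ
    ; proj-surj = surjective idₗ λ z → z , ≋-refl
    ; kills     = λ _ ()
    ; exact     = λ _ → resp K (λ ()) (has-𝟎 K)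
    }
  quotient {suc n} K with lem {∃[ v ] member K v × ¬ (v zero ≈ʳ 0ʳ)}
  ... | yes (v , v∈K , v₀≉0) =
    let (u , v₀u≈1) = invertible (v zero) v₀≉0 in
    -- Scaling `v` by minus the inverse of its first coordinate makes that coordinate -1.
    Eliminate.quotient K ((-ʳ u) · v) (has-· K (-ʳ u) v∈K)
      (R.trans (R.sym (RP.-‿distribˡ-* u (v zero)))
               (R.-‿cong (R.trans (R.*-comm u (v zero)) v₀u≈1)))
      (quotient (hyperplane-section K))
  ... | no none =
    Keep.quotient K (λ {w} w∈K → decidable-stable lem λ w₀≉0 → none (w , w∈K , w₀≉0))
      (quotient (hyperplane-section K))

-- Cospans representing total linear relations.

module Representation (ℝ : RealNumbers) (lem : ExcludedMiddle 0ℓ) where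

  open RealNumbers ℝ using (1ʳ; -ʳ_; commutativeRing)
  open Linear ℝ
  open LinearRelations ℝ
  open CopartialMaps ℝ lem
  open Subspaces ℝ lem using (Subspace; Quotient; quotient)
  private
    module R = CommutativeRing commutativeRing
    module RP = RingProperties R.ring

  rel-⊖ : ∀ {m n} (R : TotalLinearRelation m n) {x x′ y y′} →
          rel R x y → rel R x′ y′ → rel R (x ⊕ ⊖ x′) (y ⊕ ⊖ y′)
  rel-⊖ R {x′ = x′} {y′ = y′} r r′ = rel-⊕ R r
    (resp R (λ i → RP.-1*x≈-x (x′ i)) (λ i → RP.-1*x≈-x (y′ i)) (rel-· R (-ʳ 1ʳ) r′))

  -- The indeterminacy of `R`: by linearity, two outputs for the same input differ by a member.
  fibre : ∀ {m n} → TotalLinearRelation m n → Subspace n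
  fibre R = record
    { member = rel R 𝟎
    ; resp   = resp R ≋-refl
    ; has-𝟎  = rel-𝟎 R
    ; has-⊕  = λ r r′ → resp R (λ _ → R.+-identityˡ _) ≋-refl (rel-⊕ R r r′)
    ; has-·  = λ c r → resp R (λ _ → R.zeroʳ c) ≋-refl (rel-· R c r)
    }

  module _ {m n} (R : TotalLinearRelation m n) where

    private
      module Q = Quotient (quotient (fibre R))

      -- Subtracting the two related pairs leaves input 0, so the outputs differ by a member of the
      -- fibre.
      fibre-proj : ∀ {x x′ y y′} → x ≋ x′ → rel R x y → rel R x′ y′ → Q.proj $ y ≋ Q.proj $ y′
      fibre-proj x≋x′ r r′ = Q.identifies
        (resp R (λ i → RP.x≈y⇒x∙y⁻¹≈ε (x≋x′ i)) ≋-refl (rel-⊖ R r r′))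

      value : ∀ x → ∃[ y ] rel R x y
      value = total R

    -- The outputs picked by `total` need not be linear in `x`, nor even respect `≋`; modulo the
    -- fibre both defects vanish.
    classify : m ⊸ Q.apex
    classify $ x = let (y , _) = value x in Q.proj $ y
    isLinear classify = linear
      (λ {x} {x′} x≋x′ → let (_ , r) = value x; (_ , r′) = value x′ in fibre-proj x≋x′ r r′)
      (λ x x′ → let (y , r) = value x; (y′ , r′) = value x′; (_ , s) = value (x ⊕ x′) in
        ≋-trans (fibre-proj ≋-refl s (rel-⊕ R r r′)) ($-⊕ Q.proj y y′))
      (λ c x → let (y , r) = value x; (_ , s) = value (c · x) in
        ≋-trans (fibre-proj ≋-refl s (rel-· R c r)) ($-· Q.proj c y))

    copartial : Copartial m n
    apex       copartial = Q.apex
    left       copartial = classify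
    right      copartial = Q.proj
    right-surj copartial = Q.proj-surj

    copartial↦ : copartial ↦ R
    copartial↦ = represents
      -- With `y₀` the chosen output, `y - y₀` lies in the fibre, and (x, y) is the sum of (x, y₀)
      -- and (0, y - y₀).
      (λ {x} {y} fx≋py → let (y₀ , r) = value x in
        resp R (λ i → R.+-identityʳ (x i))
               (λ i → R.trans (R.sym (R.+-assoc (y₀ i) (y i) (-ʳ y₀ i)))
                              (RP.xyx⁻¹≈y (y₀ i) (y i)))
               (rel-⊕ R r (Q.separates (≋-sym fx≋py))))
      (λ {x} r → let (_ , r₀) = value x in fibre-proj ≋-refl r₀ r)

-- Coherence laws for identity comparison maps.

module IdentityLaws {o h e} {𝒞 : Category o h e} (𝓜 : SymmetricMonoidal 𝒞) where

  open Category 𝒞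
  open SymmetricMonoidal 𝓜

  idIso : ∀ {A} → A ≅ A
  idIso = record { to = id ; from = id ; to⨾from = identityˡ id ; from⨾to = identityˡ id }

  cancelˡ : ∀ {A B} {u : Hom A A} {f g : Hom A B} → u ≈ id → f ≈ g → u ⨾ f ≈ g
  cancelˡ u≈id f≈g = ≈-trans (⨾-cong u≈id f≈g) (identityˡ _)

  cancelʳ : ∀ {A B} {u : Hom B B} {f g : Hom A B} → u ≈ id → f ≈ g → f ⨾ u ≈ g
  cancelʳ u≈id f≈g = ≈-trans (⨾-cong f≈g u≈id) (identityʳ _)

  id⊗id⨾id : ∀ {A B} → id {A} ⊗₁ id {B} ⨾ id ≈ id
  id⊗id⨾id = cancelʳ ≈-refl ⊗-id

  id-natural : ∀ {A B} {f g : Hom A B} → f ≈ g → f ⨾ id ≈ id ⨾ g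
  id-natural f≈g = ≈-trans (cancelʳ ≈-refl f≈g) (≈-sym (identityˡ _))

  -- The form that `μ-assoc` takes when every `μ` is an identity.
  id⊗id-natural : ∀ {A B C D} {f g : Hom (A ⊗₀ B) (C ⊗₀ D)} → f ≈ g →
                  (id ⊗₁ id ⨾ id) ⨾ f ≈ g ⨾ id ⊗₁ id ⨾ id
  id⊗id-natural {g = g} f≈g = ≈-trans (cancelˡ id⊗id⨾id f≈g)
    (≈-sym (cancelʳ ≈-refl (cancelʳ ⊗-id ≈-refl)))

-- The two functors and the isomorphisms between their composites and the identities.

module Equivalence (lem : ExcludedMiddle 0ℓ) (ℝ : RealNumbers) where

  open Linear ℝ
  open LinearRelations ℝ
  open CopartialMaps ℝ lem
  open Representation ℝ lem
  private
    module T = MarkovCategory TLinRel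
    module C = MarkovCategory Copar-Vec
    module TI = IdentityLaws T.symmetricMonoidal
    module CI = IdentityLaws C.symmetricMonoidal

  ↦⇒≈ᴿ : ∀ {m n} {c : Copartial m n} {R} → c ↦ R → relation c ≈ᴿ R
  ↦⇒≈ᴿ p = mk≈ᴿ (sound p , complete p)

  relation-cospan : ∀ {m n} (f : m ⊸ n) → relation (cospan f) ≈ᴿ graph f
  relation-cospan f = ↦⇒≈ᴿ (cospan↦ f)

  -- The apexes may be built differently, but both cospans represent the graph of `f`, which fixes
  -- them up to isomorphism. This covers all structural maps, since they are graphs.
  copartial-graph : ∀ {m n} (f : m ⊸ n) → copartial (graph f) ≈ᶜ cospan f
  copartial-graph f = reflect (copartial↦ (graph f)) (cospan↦ f) T.≈-refl

  toCopartial : MarkovFunctor TLinRel Copar-Vec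
  toCopartial = record
    { F₀     = λ n → n
    ; F₁     = copartial
    ; F-cong = λ {_} {_} {R} {S} → reflect (copartial↦ R) (copartial↦ S)
    ; F-id   = copartial-graph idₗ
    ; F-⨾    = λ R S → reflect (copartial↦ (R ⨾ᴿ S)) (copartial↦ R ⨾↦ copartial↦ S) T.≈-refl
    -- Both tensors are `_+_` with unit 0 and objects are left unchanged, so identities serve as
    -- comparison maps.
    ; ε      = CI.idIso
    ; μ      = λ _ _ → CI.idIso
    ; μ-natural = λ R S → CI.id-natural
        (reflect (copartial↦ R ⊗↦ copartial↦ S) (copartial↦ (R ⊗ᴿ S)) T.≈-refl)
    ; μ-assoc    = λ l m n → CI.id⊗id-natural (copartial-graph (assocₗ l m n))
    ; μ-unitˡ    = λ n → CI.cancelˡ CI.id⊗id⨾id (copartial-graph (unitˡₗ n))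
    ; μ-unitʳ    = λ n → CI.cancelˡ CI.id⊗id⨾id (copartial-graph (unitʳₗ n))
    ; μ-braiding = λ m n → C.≈-sym (CI.id-natural (C.≈-sym (copartial-graph (swapₗ m n))))
    ; F-copy     = λ n → C.≈-sym (CI.cancelʳ C.≈-refl (C.≈-sym (copartial-graph (diagₗ n))))
    ; F-del      = λ n → C.≈-sym (CI.cancelʳ C.≈-refl (C.≈-sym (copartial-graph !ₗ)))
    }

  toRelation : MarkovFunctor Copar-Vec TLinRel
  toRelation = record
    { F₀     = λ n → n
    ; F₁     = relation
    ; F-cong = ≈ᶜ⇒≈ᴿ
    ; F-id   = relation-cospan idₗ
    ; F-⨾    = λ c d → ↦⇒≈ᴿ (self c ⨾↦ self d)
    ; ε      = TI.idIso
    ; μ      = λ _ _ → TI.idIso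
    ; μ-natural  = λ c d → TI.id-natural (T.≈-sym (↦⇒≈ᴿ (self c ⊗↦ self d)))
    ; μ-assoc    = λ l m n → TI.id⊗id-natural (relation-cospan (assocₗ l m n))
    ; μ-unitˡ    = λ n → TI.cancelˡ TI.id⊗id⨾id (relation-cospan (unitˡₗ n))
    ; μ-unitʳ    = λ n → TI.cancelˡ TI.id⊗id⨾id (relation-cospan (unitʳₗ n))
    ; μ-braiding = λ m n → T.≈-sym (TI.id-natural (T.≈-sym (relation-cospan (swapₗ m n))))
    ; F-copy     = λ n → T.≈-sym (TI.cancelʳ T.≈-refl (T.≈-sym (relation-cospan (diagₗ n))))
    ; F-del      = λ n → T.≈-sym (TI.cancelʳ T.≈-refl (T.≈-sym (relation-cospan !ₗ)))
    }

  unitIso : MarkovUnitIso toCopartial toRelation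
  unitIso = record
    { η         = λ _ → TI.idIso
    ; η-natural = λ R → TI.id-natural (T.≈-sym (↦⇒≈ᴿ (copartial↦ R)))
    -- The comparison maps of the composite are an identity followed by `relation` of an identity
    -- cospan.
    ; η-unit    = T.≈-sym (TI.cancelˡ T.≈-refl (relation-cospan idₗ))
    ; η-⊗       = λ _ _ → T.≈-sym (TI.cancelˡ T.⊗-id (TI.cancelˡ T.≈-refl (relation-cospan idₗ)))
    ; η-copy    = λ _ → TI.cancelˡ T.≈-refl (T.≈-sym (TI.cancelʳ T.⊗-id T.≈-refl))
    ; η-del     = λ _ → TI.cancelˡ T.≈-refl T.≈-refl
    }

  -- The round trip rebuilds the apex of `c` as a quotient. Identity components still suffice,
  -- because equality of copartial maps is isomorphism of cospans and both represent `relation c`.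
  counitIso : MarkovUnitIso toRelation toCopartial
  counitIso = record
    { η         = λ _ → CI.idIso
    ; η-natural = λ c → CI.id-natural (reflect (self c) (copartial↦ (relation c)) T.≈-refl)
    ; η-unit    = C.≈-sym (CI.cancelˡ C.≈-refl (copartial-graph idₗ))
    ; η-⊗       = λ _ _ → C.≈-sym (CI.cancelˡ C.⊗-id (CI.cancelˡ C.≈-refl (copartial-graph idₗ)))
    ; η-copy    = λ _ → CI.cancelˡ C.≈-refl (C.≈-sym (CI.cancelʳ C.⊗-id C.≈-refl))
    ; η-del     = λ _ → CI.cancelˡ C.≈-refl C.≈-refl
    }

  equivalence : MarkovEquivalence TLinRel Copar-Vec
  equivalence = record
    { functor   = toCopartial
    ; inverse   = toRelation
    ; unitIso   = unitIso
    ; counitIso = counitIso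
    }

proposition4p5 : (lem : ExcludedMiddle 0ℓ) (ℝ : RealNumbers) →
    MarkovEquivalence (LinearRelations.TLinRel ℝ) (CopartialMaps.Copar-Vec ℝ lem)
proposition4p5 = Equivalence.equivalence
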